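{- There is a deterministic algorithm that, given independence-oracle access to any partition matroid $\mathcal{M}=(E,\mathcal{I})$ on $n=|E|$ elements, finds a basis of $\mathcal{M}$ in $\widetilde{O}(n^{1/3})$ adaptive rounds, using only polynomially many (in $n$) independence queries.
   Context: A partition matroid $\mathcal{M}=(E,\mathcal{I})$ is given by a partition of the finite ground set $E$ into disjoint sets (parts) $A_1,\dots,A_m$ together with integers (budgets) $b_1,\dots,b_m$ with $0\le b_i\le |A_i|$; a set $S\subseteq E$ is independent iff $|S\cap A_i|\le b_i$ for every $i$. The algorithm knows $E$ and that the matroid is a partition matroid, but not the parts or budgets; it accesses the matroid only through an independence oracle, which on input $S\subseteq E$ reports whether $S\in\mathcal{I}$. The algorithm proceeds in adaptive rounds: in each round it submits polynomially many (in $n$) queries, which may depend only on answers received in previous rounds, and receives all answers simultaneously. Only rounds and queries are counted, and the algorithm may be non-uniform (for each $n$ a fixed deterministic adaptive query strategy). A basis is a maximal independent set. $\widetilde{O}(\cdot)$ hides factors polylogarithmic in its argument. -}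

module Defs where

open import Data.Bool.Base using (Bool)
open import Data.Fin.Base using (Fin)
open import Data.Fin.Properties using (all?)
open import Data.Fin.Subset using (Subset; _∈_; _∩_; _⊂_; Empty; ∣_∣)
open import Data.Nat.Base using (ℕ; suc; _+_; _*_; _^_; _≤_)
open import Data.Nat.Logarithm using (⌊log₂_⌋)
open import Data.Nat.Properties using (_≤?_)
open import Data.Product.Base using (∃; ∃₂; _×_)
open import Data.Vec.Base using (Vec; map)
open import Relation.Binary.PropositionalEquality.Core using (_≢_)
open import Relation.Nullary.Decidable using (Dec; ⌊_⌋)
open import Relation.Nullary.Negation using (¬_)

-- The ground set is Fin n.  Parts may be empty (their budget is then 0);
-- such parts impose no constraint on independence.
record PartitionMatroid (n : ℕ) : Set where
  field
    m        : ℕ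
    A        : Fin m → Subset n
    b        : Fin m → ℕ
    disjoint : ∀ {i j} → i ≢ j → Empty (A i ∩ A j)
    cover    : ∀ e → ∃ λ i → e ∈ A i
    b≤∣A∣    : ∀ i → b i ≤ ∣ A i ∣

  Independent : Subset n → Set
  Independent S = ∀ i → ∣ S ∩ A i ∣ ≤ b i

  independent? : ∀ S → Dec (Independent S)
  independent? S = all? λ i → ∣ S ∩ A i ∣ ≤? b i

  IsBasis : Subset n → Set
  IsBasis B = Independent B × (∀ {S} → B ⊂ S → ¬ Independent S)

  oracle : Subset n → Bool
  oracle S = ⌊ independent? S ⌋

-- A deterministic adaptive query strategy on ground set Fin n, as a decision
-- tree: `ask qs next` submits all the queries qs in a single round and
-- continues with a strategy depending on the answers to that round.
data Algorithm (n : ℕ) : Set where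
  return : Subset n → Algorithm n
  ask    : ∀ {q} → Vec (Subset n) q → (Vec Bool q → Algorithm n) → Algorithm n

module _ {n : ℕ} (oracle : Subset n → Bool) where

  output : Algorithm n → Subset n
  output (return S)    = S
  output (ask qs next) = output (next (map oracle qs))

  rounds : Algorithm n → ℕ
  rounds (return S)    = 0
  rounds (ask qs next) = suc (rounds (next (map oracle qs)))

  -- Total over all rounds of the execution.
  queries : Algorithm n → ℕ
  queries (return S)        = 0
  queries (ask {q} qs next) = q + queries (next (map oracle qs))

-- f(n) = Õ(n^{1/3}): the inequality f(n) ≤ c · (1 + ⌊log₂ n⌋)ᵏ · n^{1/3} for
-- all n, with both sides cubed to stay in ℕ.  Taking log n rather than
-- log (n^{1/3}) only changes c, and the 1 + keeps the factor positive at n = 1.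
IsÕ[∛n] : (ℕ → ℕ) → Set
IsÕ[∛n] f = ∃₂ λ c k → ∀ n → f n ^ 3 ≤ (c * suc ⌊log₂ n ⌋ ^ k) ^ 3 * n

PolynomiallyBounded : (ℕ → ℕ) → Set
PolynomiallyBounded f = ∃₂ λ c d → ∀ n → f n ≤ c * suc n ^ d

{-# OPTIONS --safe #-}
module Submission where

-- Let S contain each element independently with probability p.  If S exceeds
-- the budget of the part A and of no other part, then some prefix of S exceeds
-- it by one, and deleting single elements from that prefix exhibits a circuit
-- inside A, hence the whole of A.  Such a part is solved by any b of its
-- elements and is set aside; nothing is ever contracted.
--
-- As long as p is so small that every remaining part is exceeded with
-- probability at most 1/H, a part exceeded with probability at least
-- 1/(2H²) is the only one exceeded with probability at least 1/(4H²).  By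
-- greedy derandomisation, polynomially many fixed sets S serve all partition
-- matroids at once.  By Cauchy-Schwarz, multiplying the odds p/(1-p) by
-- 1 + 1/n^(1/3) changes the probability that a part of at most n^(2/3)
-- elements is exceeded from above 1/H to no less than 1/(2H²).  So each step
-- either finds a part with more than n^(2/3) elements, which happens at most
-- n^(1/3) times, or finds every small part that becomes likely to be exceeded
-- at the next of O(n^(1/3) log n) values of the odds.

open import Data.Bool.Base using (Bool; true; false; _∧_; _∨_; not)
open import Data.Bool.Properties as Bool using (∨-zeroʳ)
open import Data.Fin.Base using (Fin; zero; suc; combine; remQuot; toℕ; fromℕ<)
open import Data.Fin.Properties using (all?; ¬∀⟶∃¬; remQuot-combine; _≟_; toℕ-fromℕ<)
open import Data.Fin.Subset
open import Data.Fin.Subset.Properties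
open import Data.List.Base as List using (List; []; _∷_; length; filter; cartesianProduct; cartesianProductWith; upTo)
open import Data.List.Membership.Propositional using () renaming (_∈_ to _∈ˡ_)
open import Data.List.Membership.Propositional.Properties using (∈-filter⁺; ∈-filter⁻; ∈-cartesianProductWith⁺; ∈-cartesianProduct⁺; ∈-upTo⁺)
open import Data.List.Properties using (length-++; length-map; length-upTo; length-filter)
open import Data.List.Relation.Unary.Any using (here; there)
open import Data.Nat.Base
open import Data.Nat.Logarithm using (⌊log₂_⌋; ⌊log₂⌋-mono-≤; ⌊log₂[2^n]⌋≡n)
open import Data.Nat.Properties hiding (_≟_)
import Data.Nat.Properties as ℕ
open import Data.Nat.Tactic.RingSolver using (solve-∀)
open import Data.Product.Base using (Σ-syntax; ∃; _×_; _,_; proj₁; proj₂; uncurry)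
open import Data.Sum.Base using (_⊎_; inj₁; inj₂; [_,_]′)
open import Data.Vec.Base as Vec using (Vec; []; _∷_; tabulate; lookup; map; here; there)
open import Data.Vec.Properties using (lookup-map; lookup∘tabulate; []=⇒lookup; lookup⇒[]=)
open import Function.Base using (_∘_; it)
open import Relation.Binary.PropositionalEquality using (_≡_; _≢_; refl; sym; trans; cong; cong₂; subst; subst₂)
open import Relation.Nullary.Decidable using (Dec; yes; no; ⌊_⌋; dec-true; dec-false; decidable-stable; isYes≗does; _⊎-dec_)
open import Relation.Nullary.Negation using (¬_; contradiction)
open import Relation.Unary using (Decidable)
open import Defs

open ≤-Reasoning

-- Powers and products

-- Bernoulli's inequality 1 + s/x ≤ (1 + 1/x)^s, cleared of denominators.
bernoulli : ∀ x s → x ^ s * (x + s) ≤ suc x ^ s * x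
bernoulli x zero = ≤-reflexive (cong (1 *_) (+-identityʳ x))
bernoulli x (suc s) = begin
  x * x ^ s * (x + suc s)       ≡⟨ eq₁ x s (x ^ s) ⟩
  x ^ s * (x + s) * x + x ^ s * x ≤⟨ +-monoʳ-≤ (x ^ s * (x + s) * x) (*-monoʳ-≤ (x ^ s) (m≤m+n x s)) ⟩
  x ^ s * (x + s) * x + x ^ s * (x + s) ≡⟨ eq₂ x (x ^ s * (x + s)) ⟩
  suc x * (x ^ s * (x + s))     ≤⟨ *-monoʳ-≤ (suc x) (bernoulli x s) ⟩
  suc x * (suc x ^ s * x)       ≡⟨ *-assoc (suc x) (suc x ^ s) x ⟨
  suc x * suc x ^ s * x         ∎
  where
  eq₁ : ∀ x s p → x * p * (x + suc s) ≡ p * (x + s) * x + p * x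
  eq₁ = solve-∀
  eq₂ : ∀ x p → p * x + p ≡ suc x * p
  eq₂ = solve-∀

-- Bernoulli with s = x, that is (1 + 1/x)^x ≥ 2. It yields both the halving in the greedy argument
-- and the doubling of the odds.
2*x^x≤[1+x]^x : ∀ x .{{_ : NonZero x}} → 2 * x ^ x ≤ suc x ^ x
2*x^x≤[1+x]^x x = *-cancelʳ-≤ _ _ x (≤-trans (≤-reflexive (eq x (x ^ x))) (bernoulli x x))
  where
  eq : ∀ x p → 2 * p * x ≡ p * (x + x)
  eq = solve-∀

-- (1 + y/x)^s ≤ 1/(1 − sy/x), with the subtraction moved into x = sy + z.
reverse-bernoulli : ∀ s y z → let x = s * y + z in (x + y) ^ s * z ≤ x ^ s * x
reverse-bernoulli zero y z = ≤-refl
reverse-bernoulli (suc s) y z = begin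
  (x + y) * (x + y) ^ s * z   ≡⟨ eq₁ (x + y) ((x + y) ^ s) z ⟩
  (x + y) ^ s * ((x + y) * z) ≤⟨ *-monoʳ-≤ ((x + y) ^ s) x+y*z≤ ⟩
  (x + y) ^ s * ((y + z) * x) ≡⟨ *-assoc ((x + y) ^ s) (y + z) x ⟨
  (x + y) ^ s * (y + z) * x   ≤⟨ *-monoˡ-≤ x ih ⟩
  x ^ s * x * x               ≡⟨ cong (_* x) (*-comm (x ^ s) x) ⟩
  x * x ^ s * x               ∎
  where
  x = suc s * y + z
  x≡ : x ≡ s * y + (y + z)
  x≡ = eq s y z
    where
    eq : ∀ s y z → suc s * y + z ≡ s * y + (y + z)
    eq = solve-∀
  ih : (x + y) ^ s * (y + z) ≤ x ^ s * x
  ih = subst (λ w → (w + y) ^ s * (y + z) ≤ w ^ s * w) (sym x≡) (reverse-bernoulli s y (y + z))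
  eq₁ : ∀ u p z → u * p * z ≡ p * (u * z)
  eq₁ = solve-∀
  x+y*z≤ : (x + y) * z ≤ (y + z) * x
  x+y*z≤ = begin
    (x + y) * z   ≡⟨ *-distribʳ-+ z x y ⟩
    x * z + y * z ≤⟨ +-monoʳ-≤ (x * z) (*-monoʳ-≤ y (m≤n+m z (suc s * y))) ⟩
    x * z + y * x ≡⟨ eq₂ x y z ⟩
    (y + z) * x   ∎
    where
    eq₂ : ∀ x y z → x * z + y * x ≡ (y + z) * x
    eq₂ = solve-∀

-- `reverse-bernoulli` with z = x - sy, which by hypothesis is at least x/2.
[x+y]^s≤2x^s : ∀ s x y .{{_ : NonZero x}} → 2 * (s * y) ≤ x → (x + y) ^ s ≤ 2 * x ^ s
[x+y]^s≤2x^s s x y 2sy≤x = *-cancelʳ-≤ _ _ x (begin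
  (x + y) ^ s * x       ≤⟨ *-monoʳ-≤ ((x + y) ^ s) x≤2z ⟩
  (x + y) ^ s * (2 * z) ≡⟨ eq₁ ((x + y) ^ s) z ⟩
  2 * ((x + y) ^ s * z) ≤⟨ *-monoʳ-≤ 2 (subst (λ w → (w + y) ^ s * z ≤ w ^ s * w) (m+[n∸m]≡n sy≤x) (reverse-bernoulli s y z)) ⟩
  2 * (x ^ s * x)       ≡⟨ *-assoc 2 (x ^ s) x ⟨
  2 * x ^ s * x         ∎)
  where
  sy≤x : s * y ≤ x
  sy≤x = ≤-trans (m≤m+n (s * y) _) 2sy≤x
  z = x ∸ s * y
  eq₁ : ∀ p z → p * (2 * z) ≡ 2 * (p * z)
  eq₁ = solve-∀
  x≤2z : x ≤ 2 * z
  x≤2z = +-cancelˡ-≤ (2 * (s * y)) _ _ (begin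
    2 * (s * y) + x       ≤⟨ +-monoˡ-≤ x 2sy≤x ⟩
    x + x                 ≡⟨ cong (λ w → w + w) (m+[n∸m]≡n sy≤x) ⟨
    (s * y + z) + (s * y + z) ≡⟨ eq₂ (s * y) z ⟩
    2 * (s * y) + 2 * z   ∎)
    where
    eq₂ : ∀ u z → (u + z) + (u + z) ≡ 2 * u + 2 * z
    eq₂ = solve-∀

4uv≤[u+v]² : ∀ u v → 4 * (u * v) ≤ (u + v) * (u + v)
4uv≤[u+v]² u v = [ ordered , (λ v≤u → subst₂ _≤_ (cong (4 *_) (*-comm v u)) (cong (λ w → w * w) (+-comm v u)) (ordered v≤u)) ]′ (≤-total u v)
  where
  eq : ∀ u w → (u + (u + w)) * (u + (u + w)) ≡ 4 * (u * (u + w)) + w * w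
  eq = solve-∀
  ordered : ∀ {u v} → u ≤ v → 4 * (u * v) ≤ (u + v) * (u + v)
  ordered {u} u≤v with w , refl ← m≤n⇒∃[o]m+o≡n u≤v = ≤-trans (m≤m+n _ (w * w)) (≤-reflexive (sym (eq u w)))

m*m≤n*n⇒m≤n : ∀ {m n} → m * m ≤ n * n → m ≤ n
m*m≤n*n⇒m≤n {m} {n} mm≤nn with m ≤? n
... | yes m≤n = m≤n
... | no  m≰n = contradiction mm≤nn (<⇒≱ (*-mono-< (≰⇒> m≰n) (≰⇒> m≰n)))

-- AM-GM, compared after squaring so that no root appears.
p²≤uv⇒2p≤u+v : ∀ p u v → p * p ≤ u * v → 2 * p ≤ u + v
p²≤uv⇒2p≤u+v p u v p²≤uv = m*m≤n*n⇒m≤n (begin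
  2 * p * (2 * p)   ≡⟨ eq p ⟩
  4 * (p * p)       ≤⟨ *-monoʳ-≤ 4 p²≤uv ⟩
  4 * (u * v)       ≤⟨ 4uv≤[u+v]² u v ⟩
  (u + v) * (u + v) ∎)
  where
  eq : ∀ p → 2 * p * (2 * p) ≡ 4 * (p * p)
  eq = solve-∀

^-distribʳ-* : ∀ m n o → (m * n) ^ o ≡ m ^ o * n ^ o
^-distribʳ-* m n zero = refl
^-distribʳ-* m n (suc o) = trans (cong (m * n *_) (^-distribʳ-* m n o)) (eq m n (m ^ o) (n ^ o))
  where
  eq : ∀ m n p q → m * n * (p * q) ≡ m * p * (n * q)
  eq = solve-∀

-- Weighted sums over subsets

-- The sum of f S over all S ⊆ A, where S has weight a^∣S∣ c^∣A ─ S∣.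
wsum : ∀ {n} → ℕ → ℕ → Subset n → (Subset n → ℕ) → ℕ
wsum a c []            f = f []
wsum a c (inside ∷ A)  f = a * wsum a c A (f ∘ (inside ∷_)) + c * wsum a c A (f ∘ (outside ∷_))
wsum a c (outside ∷ A) f = wsum a c A (f ∘ (outside ∷_))

module _ (a c : ℕ) where

  wsum-mono : ∀ {n} (A : Subset n) {f g} → (∀ S → f S ≤ g S) → wsum a c A f ≤ wsum a c A g
  wsum-mono []            f≤g = f≤g []
  wsum-mono (inside ∷ A)  f≤g = +-mono-≤ (*-monoʳ-≤ a (wsum-mono A λ S → f≤g _)) (*-monoʳ-≤ c (wsum-mono A λ S → f≤g _))
  wsum-mono (outside ∷ A) f≤g = wsum-mono A λ S → f≤g _

  wsum-cong : ∀ {n} (A : Subset n) {f g} → (∀ S → f S ≡ g S) → wsum a c A f ≡ wsum a c A g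
  wsum-cong A f≡g = ≤-antisym (wsum-mono A (≤-reflexive ∘ f≡g)) (wsum-mono A (≤-reflexive ∘ sym ∘ f≡g))

  wsum-+ : ∀ {n} (A : Subset n) f g → wsum a c A (λ S → f S + g S) ≡ wsum a c A f + wsum a c A g
  wsum-+ []            f g = refl
  wsum-+ (inside ∷ A)  f g = trans (cong₂ (λ u v → a * u + c * v) (wsum-+ A _ _) (wsum-+ A _ _)) (eq a c _ _ _ _)
    where
    eq : ∀ a c u v p q → a * (u + v) + c * (p + q) ≡ (a * u + c * p) + (a * v + c * q)
    eq = solve-∀
  wsum-+ (outside ∷ A) f g = wsum-+ A _ _

  wsum-const : ∀ {n} (A : Subset n) k → wsum a c A (λ _ → k) ≡ k * (a + c) ^ ∣ A ∣
  wsum-const []            k = sym (*-identityʳ k)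
  wsum-const (inside ∷ A)  k = trans (cong (λ w → a * w + c * w) (wsum-const A k)) (eq a c k ((a + c) ^ ∣ A ∣))
    where
    eq : ∀ a c k p → a * (k * p) + c * (k * p) ≡ k * ((a + c) * p)
    eq = solve-∀
  wsum-const (outside ∷ A) k = wsum-const A k

  wsum≤total : ∀ {n} (A : Subset n) {f} → (∀ S → f S ≤ 1) → wsum a c A f ≤ (a + c) ^ ∣ A ∣
  wsum≤total A f≤1 = ≤-trans (wsum-mono A f≤1) (≤-reflexive (trans (wsum-const A 1) (*-identityˡ _)))

  -- Linearity of expectation in the form of a union bound; `H` stays on the left in place of a
  -- division.
  wsum-Σ : ∀ {n k} H (A : Subset n) (f : Fin k → Subset n → ℕ) {w} → (∀ i → H * wsum a c A (f i) ≤ w) →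
           H * wsum a c A (λ S → Vec.sum (tabulate λ i → f i S)) ≤ k * w
  wsum-Σ {k = zero}  H A f f≤w = ≤-reflexive (trans (cong (H *_) (wsum-const A 0)) (*-zeroʳ H))
  wsum-Σ {k = suc k} H A f f≤w = ≤-trans
    (≤-reflexive (trans (cong (H *_) (wsum-+ A _ _)) (*-distribˡ-+ H _ _)))
    (+-mono-≤ (f≤w zero) (wsum-Σ H A (f ∘ suc) (f≤w ∘ suc)))

  -- Under the product measure `S ∩ A` and `S ∩ ∁ A` are independent, so expectations multiply.
  wsum-∩-∁ : ∀ {n} (A : Subset n) f g →
             wsum a c ⊤ (λ S → f (S ∩ A) * g (S ∩ ∁ A)) ≡ wsum a c A f * wsum a c (∁ A) g
  wsum-∩-∁ []            f g = refl
  wsum-∩-∁ (inside ∷ A)  f g =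
    trans (cong₂ (λ u v → a * u + c * v) (wsum-∩-∁ A (f ∘ (inside ∷_)) g₀) (wsum-∩-∁ A (f ∘ (outside ∷_)) g₀))
          (eq a c (wsum a c A (f ∘ (inside ∷_))) (wsum a c A (f ∘ (outside ∷_))) (wsum a c (∁ A) g₀))
    where
    g₀ = g ∘ (outside ∷_)
    eq : ∀ a c u v w → a * (u * w) + c * (v * w) ≡ (a * u + c * v) * w
    eq = solve-∀
  wsum-∩-∁ (outside ∷ A) f g =
    trans (cong₂ (λ u v → a * u + c * v) (wsum-∩-∁ A f₀ (g ∘ (inside ∷_))) (wsum-∩-∁ A f₀ (g ∘ (outside ∷_))))
          (eq a c (wsum a c A f₀) (wsum a c (∁ A) (g ∘ (inside ∷_))) (wsum a c (∁ A) (g ∘ (outside ∷_))))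
    where
    f₀ = f ∘ (outside ∷_)
    eq : ∀ a c w u v → a * (w * u) + c * (w * v) ≡ w * (a * u + c * v)
    eq = solve-∀

  ∣A∣+∣∁A∣≡n : ∀ {n} (A : Subset n) → ∣ A ∣ + ∣ ∁ A ∣ ≡ n
  ∣A∣+∣∁A∣≡n A = trans (cong (∣ A ∣ +_) (∣∁p∣≡n∸∣p∣ A)) (m+[n∸m]≡n (∣p∣≤n A))

  total-split : ∀ {n} (A : Subset n) → (a + c) ^ ∣ A ∣ * (a + c) ^ ∣ ∁ A ∣ ≡ (a + c) ^ n
  total-split A = trans (sym (^-distribˡ-+-* (a + c) ∣ A ∣ _)) (cong ((a + c) ^_) (∣A∣+∣∁A∣≡n A))

  wsum-∩ : ∀ {n} (A : Subset n) f → wsum a c ⊤ (λ S → f (S ∩ A)) ≡ wsum a c A f * (a + c) ^ ∣ ∁ A ∣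
  wsum-∩ {n} A f = begin-equality
    wsum a c ⊤ (λ S → f (S ∩ A))               ≡⟨ wsum-cong (⊤ {n}) (λ S → *-identityʳ (f (S ∩ A))) ⟨
    wsum a c ⊤ (λ S → f (S ∩ A) * 1)           ≡⟨ wsum-∩-∁ A f (λ _ → 1) ⟩
    wsum a c A f * wsum a c (∁ A) (λ _ → 1)    ≡⟨ cong (wsum a c A f *_) (trans (wsum-const (∁ A) 1) (*-identityˡ _)) ⟩
    wsum a c A f * (a + c) ^ ∣ ∁ A ∣           ∎

  -- Method of conditional expectations: keeping at each element the better of the two choices
  -- reaches the average.
  wsum-max : ∀ {n} (A : Subset n) f → ∃ λ S → wsum a c A f ≤ f S * (a + c) ^ ∣ A ∣
  wsum-max []            f = [] , ≤-reflexive (sym (*-identityʳ _))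
  wsum-max (outside ∷ A) f with S , p ← wsum-max A (f ∘ (outside ∷_)) = _ , p
  wsum-max (inside ∷ A)  f with wsum-max A (f ∘ (inside ∷_)) | wsum-max A (f ∘ (outside ∷_))
  ... | S , p | S′ , q with ≤-total (f (inside ∷ S)) (f (outside ∷ S′))
  ... | inj₁ ≤ = outside ∷ S′ , ≤-trans (+-mono-≤ (*-monoʳ-≤ a (≤-trans p (*-monoˡ-≤ _ ≤))) (*-monoʳ-≤ c q)) (≤-reflexive (eq a c (f (outside ∷ S′)) ((a + c) ^ ∣ A ∣)))
    where
    eq : ∀ a c k p → a * (k * p) + c * (k * p) ≡ k * ((a + c) * p)
    eq = solve-∀
  ... | inj₂ ≥ = inside ∷ S , ≤-trans (+-mono-≤ (*-monoʳ-≤ a p) (*-monoʳ-≤ c (≤-trans q (*-monoˡ-≤ _ ≥)))) (≤-reflexive (eq a c (f (inside ∷ S)) ((a + c) ^ ∣ A ∣)))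
    where
    eq : ∀ a c k p → a * (k * p) + c * (k * p) ≡ k * ((a + c) * p)
    eq = solve-∀

  wsum≥full : ∀ {n} (A : Subset n) f → f A * a ^ ∣ A ∣ ≤ wsum a c A f
  wsum≥full []            f = ≤-reflexive (*-identityʳ _)
  wsum≥full (outside ∷ A) f = wsum≥full A _
  wsum≥full (inside ∷ A)  f = begin
    f (inside ∷ A) * (a * a ^ ∣ A ∣)        ≡⟨ eq (f (inside ∷ A)) a (a ^ ∣ A ∣) ⟩
    a * (f (inside ∷ A) * a ^ ∣ A ∣)        ≤⟨ *-monoʳ-≤ a (wsum≥full A _) ⟩
    a * wsum a c A (f ∘ (inside ∷_))        ≤⟨ m≤m+n _ _ ⟩
    wsum a c (inside ∷ A) f                 ∎
    where
    eq : ∀ u a p → u * (a * p) ≡ a * (u * p)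
    eq = solve-∀

  -- As `f` vanishes at `⊥`, the weight c^∣A∣ of the empty set is missing from the sum.
  wsum+empty≤total : ∀ {n} (A : Subset n) {f} → (∀ S → f S ≤ 1) → f ⊥ ≡ 0 →
                     wsum a c A f + c ^ ∣ A ∣ ≤ (a + c) ^ ∣ A ∣
  wsum+empty≤total []            f≤1 f⊥ = ≤-reflexive (cong (_+ 1) f⊥)
  wsum+empty≤total (outside ∷ A) f≤1 f⊥ = wsum+empty≤total A (λ S → f≤1 _) f⊥
  wsum+empty≤total (inside ∷ A)  {f} f≤1 f⊥ = begin
    a * W₁ + c * W₀ + c * c ^ s ≡⟨ eq a c W₁ W₀ (c ^ s) ⟩
    a * W₁ + c * (W₀ + c ^ s)   ≤⟨ +-mono-≤ (*-monoʳ-≤ a (wsum≤total A λ S → f≤1 _)) (*-monoʳ-≤ c (wsum+empty≤total A (λ S → f≤1 _) f⊥)) ⟩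
    a * (a + c) ^ s + c * (a + c) ^ s ≡⟨ *-distribʳ-+ ((a + c) ^ s) a c ⟨
    (a + c) * (a + c) ^ s       ∎
    where
    s  = ∣ A ∣
    W₁ = wsum a c A (f ∘ (inside ∷_))
    W₀ = wsum a c A (f ∘ (outside ∷_))
    eq : ∀ a c u v p → a * u + c * v + c * p ≡ a * u + c * (v + p)
    eq = solve-∀

-- The weight of S on the left is the geometric mean of its two weights on the right. The induction
-- hypotheses bound the square terms, and AM-GM applied to their product bounds the mixed term.
wsum-cauchy-schwarz : ∀ {n} a c g h (A : Subset n) f →
  wsum (a * g) (c * h) A f * wsum (a * g) (c * h) A f ≤
  wsum a c A f * wsum (a * (g * g)) (c * (h * h)) A f
wsum-cauchy-schwarz a c g h []            f = ≤-refl
wsum-cauchy-schwarz a c g h (outside ∷ A) f = wsum-cauchy-schwarz a c g h A _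
wsum-cauchy-schwarz a c g h (inside ∷ A)  f = begin
  (a * g * X₂ + c * h * Y₂) * (a * g * X₂ + c * h * Y₂)
    ≡⟨ eq₁ a c g h X₂ Y₂ ⟩
  a * g * (a * g) * (X₂ * X₂) + c * h * (c * h) * (Y₂ * Y₂) + a * c * (2 * (g * h * (X₂ * Y₂)))
    ≤⟨ +-mono-≤ (+-mono-≤ (*-monoʳ-≤ (a * g * (a * g)) X-ih) (*-monoʳ-≤ (c * h * (c * h)) Y-ih)) (*-monoʳ-≤ (a * c) cross) ⟩
  a * g * (a * g) * (X₁ * X₃) + c * h * (c * h) * (Y₁ * Y₃) + a * c * (h * h * (X₁ * Y₃) + g * g * (X₃ * Y₁))
    ≡⟨ eq₂ a c g h X₁ Y₁ X₃ Y₃ ⟩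
  (a * X₁ + c * Y₁) * (a * (g * g) * X₃ + c * (h * h) * Y₃) ∎
  where
  X₁ = wsum a c A (f ∘ (inside ∷_))
  Y₁ = wsum a c A (f ∘ (outside ∷_))
  X₂ = wsum (a * g) (c * h) A (f ∘ (inside ∷_))
  Y₂ = wsum (a * g) (c * h) A (f ∘ (outside ∷_))
  X₃ = wsum (a * (g * g)) (c * (h * h)) A (f ∘ (inside ∷_))
  Y₃ = wsum (a * (g * g)) (c * (h * h)) A (f ∘ (outside ∷_))
  X-ih : X₂ * X₂ ≤ X₁ * X₃
  X-ih = wsum-cauchy-schwarz a c g h A _
  Y-ih : Y₂ * Y₂ ≤ Y₁ * Y₃
  Y-ih = wsum-cauchy-schwarz a c g h A _
  eq₁ : ∀ a c g h x y → (a * g * x + c * h * y) * (a * g * x + c * h * y) ≡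
    a * g * (a * g) * (x * x) + c * h * (c * h) * (y * y) + a * c * (2 * (g * h * (x * y)))
  eq₁ = solve-∀
  eq₂ : ∀ a c g h x₁ y₁ x₃ y₃ →
    a * g * (a * g) * (x₁ * x₃) + c * h * (c * h) * (y₁ * y₃) + a * c * (h * h * (x₁ * y₃) + g * g * (x₃ * y₁)) ≡
    (a * x₁ + c * y₁) * (a * (g * g) * x₃ + c * (h * h) * y₃)
  eq₂ = solve-∀
  cross : 2 * (g * h * (X₂ * Y₂)) ≤ h * h * (X₁ * Y₃) + g * g * (X₃ * Y₁)
  cross = p²≤uv⇒2p≤u+v (g * h * (X₂ * Y₂)) (h * h * (X₁ * Y₃)) (g * g * (X₃ * Y₁)) (begin
    g * h * (X₂ * Y₂) * (g * h * (X₂ * Y₂))       ≡⟨ eq₃ g h X₂ Y₂ ⟩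
    g * h * (g * h) * (X₂ * X₂ * (Y₂ * Y₂))       ≤⟨ *-monoʳ-≤ (g * h * (g * h)) (*-mono-≤ X-ih Y-ih) ⟩
    g * h * (g * h) * (X₁ * X₃ * (Y₁ * Y₃))       ≡⟨ eq₄ g h X₁ X₃ Y₁ Y₃ ⟩
    h * h * (X₁ * Y₃) * (g * g * (X₃ * Y₁))       ∎)
    where
    eq₃ : ∀ g h x y → g * h * (x * y) * (g * h * (x * y)) ≡ g * h * (g * h) * (x * x * (y * y))
    eq₃ = solve-∀
    eq₄ : ∀ g h x₁ x₃ y₁ y₃ → g * h * (g * h) * (x₁ * x₃ * (y₁ * y₃)) ≡ h * h * (x₁ * y₃) * (g * g * (x₃ * y₁))
    eq₄ = solve-∀

-- P_{q′}(f)² ≤ P_q(f) · E_q[(dP_{q′}/dP_q)²]: since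
-- (a+c)(ag²+ch²) = (ag+ch)² + ac(g−h)², the second moment of the likelihood
-- ratio is at most (1 + (g−h)²/4gh)^∣A∣, hence at most 2 here.
change-of-measure : ∀ {n} a c h d H (A : Subset n) {f} .{{_ : NonZero a}} .{{_ : NonZero c}} .{{_ : NonZero h}} →
  (∀ S → f S ≤ 1) → let g = h + d in
  ∣ A ∣ * (d * d) ≤ 2 * (g * h) →
  (a * g + c * h) ^ ∣ A ∣ ≤ H * wsum (a * g) (c * h) A f →
  (a + c) ^ ∣ A ∣ ≤ 2 * (H * H) * wsum a c A f
change-of-measure a c h d H A {f} f≤1 sd²≤2gh Z₂≤HW₂ =
  *-cancelʳ-≤ _ _ (u ^ s) {{m^n≢0 u s {{u≢0}}}} (begin
    (a + c) ^ s * u ^ s         ≡⟨ ^-distribʳ-* (a + c) u s ⟨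
    ((a + c) * u) ^ s           ≡⟨ cong (_^ s) (eq₁ a c h d) ⟩
    (v * v + a * c * (d * d)) ^ s ≤⟨ [x+y]^s≤2x^s s (v * v) (a * c * (d * d)) {{m*n≢0 v v {{v≢0}} {{v≢0}}}} small ⟩
    2 * (v * v) ^ s             ≡⟨ cong (2 *_) (^-distribʳ-* v v s) ⟩
    2 * (v ^ s * v ^ s)         ≤⟨ *-monoʳ-≤ 2 (*-mono-≤ Z₂≤HW₂ Z₂≤HW₂) ⟩
    2 * (H * W₂ * (H * W₂))     ≡⟨ eq₂ H W₂ ⟩
    2 * (H * H) * (W₂ * W₂)     ≤⟨ *-monoʳ-≤ (2 * (H * H)) (wsum-cauchy-schwarz a c g h A f) ⟩
    2 * (H * H) * (W * W₃)      ≤⟨ *-monoʳ-≤ (2 * (H * H)) (*-monoʳ-≤ W (wsum≤total _ _ A f≤1)) ⟩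
    2 * (H * H) * (W * u ^ s)   ≡⟨ *-assoc (2 * (H * H)) W (u ^ s) ⟨
    2 * (H * H) * W * u ^ s     ∎)
  where
  g = h + d
  s = ∣ A ∣
  u = a * (g * g) + c * (h * h)
  v = a * g + c * h
  W = wsum a c A f
  W₂ = wsum (a * g) (c * h) A f
  W₃ = wsum (a * (g * g)) (c * (h * h)) A f
  ch≢0 : NonZero (c * h)
  ch≢0 = m*n≢0 c h
  v≢0 : NonZero v
  v≢0 = >-nonZero (≤-trans (>-nonZero⁻¹ (c * h) {{ch≢0}}) (m≤n+m (c * h) (a * g)))
  u≢0 : NonZero u
  u≢0 = >-nonZero (≤-trans (>-nonZero⁻¹ (c * (h * h)) {{m*n≢0 c (h * h) {{it}} {{m*n≢0 h h}}}}) (m≤n+m _ (a * (g * g))))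
  eq₁ : ∀ a c h d → let g = h + d in (a + c) * (a * (g * g) + c * (h * h)) ≡
        (a * g + c * h) * (a * g + c * h) + a * c * (d * d)
  eq₁ = solve-∀
  eq₂ : ∀ H w → 2 * (H * w * (H * w)) ≡ 2 * (H * H) * (w * w)
  eq₂ = solve-∀
  small : 2 * (s * (a * c * (d * d))) ≤ v * v
  small = begin
    2 * (s * (a * c * (d * d)))   ≡⟨ eq₃ s a c d ⟩
    2 * (a * c) * (s * (d * d))   ≤⟨ *-monoʳ-≤ (2 * (a * c)) sd²≤2gh ⟩
    2 * (a * c) * (2 * (g * h))   ≡⟨ eq₄ a c g h ⟩
    4 * (a * g * (c * h))         ≤⟨ 4uv≤[u+v]² (a * g) (c * h) ⟩
    v * v                         ∎
    where
    eq₃ : ∀ s a c d → 2 * (s * (a * c * (d * d))) ≡ 2 * (a * c) * (s * (d * d))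
    eq₃ = solve-∀
    eq₄ : ∀ a c g h → 2 * (a * c) * (2 * (g * h)) ≡ 4 * (a * g * (c * h))
    eq₄ = solve-∀

-- Greedy hitting sets

𝟙 : Bool → ℕ
𝟙 true  = 1
𝟙 false = 0

𝟙≤1 : ∀ x → 𝟙 x ≤ 1
𝟙≤1 true  = ≤-refl
𝟙≤1 false = z≤n

𝟙-∧ : ∀ x y → 𝟙 (x ∧ y) ≡ 𝟙 x * 𝟙 y
𝟙-∧ true  y = sym (+-identityʳ _)
𝟙-∧ false y = refl

module _ {n} {X : Set} (a c : ℕ) .{{a+c≢0 : NonZero (a + c)}} (p : X → Subset n → Bool) where

  private
    hits : List X → Subset n → ℕ
    hits []      S = 0
    hits (x ∷ Γ) S = 𝟙 (p x S) + hits Γ S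

    missed? : ∀ S → Decidable (λ x → p x S ≡ false)
    missed? S x = p x S Bool.≟ false

    -- Linearity of expectation: a random set hits on average at least a 1/C fraction of `Γ`.
    wsum-hits : ∀ C Γ → (∀ {x} → x ∈ˡ Γ → (a + c) ^ n ≤ C * wsum a c ⊤ (𝟙 ∘ p x)) →
                length Γ * (a + c) ^ n ≤ C * wsum a c ⊤ (hits Γ)
    wsum-hits C []      _ = z≤n
    wsum-hits C (x ∷ Γ) heavy = begin
      (a + c) ^ n + length Γ * (a + c) ^ n ≤⟨ +-mono-≤ (heavy (here refl)) (wsum-hits C Γ (heavy ∘ there)) ⟩
      C * wsum a c ⊤ (𝟙 ∘ p x) + C * wsum a c ⊤ (hits Γ) ≡⟨ *-distribˡ-+ C _ _ ⟨
      C * (wsum a c ⊤ (𝟙 ∘ p x) + wsum a c ⊤ (hits Γ)) ≡⟨ cong (C *_) (wsum-+ a c (⊤ {n}) (𝟙 ∘ p x) (hits Γ)) ⟨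
      C * wsum a c ⊤ (hits (x ∷ Γ))  ∎

    hits+missed : ∀ Γ S → hits Γ S + length (filter (missed? S) Γ) ≤ length Γ
    hits+missed []      S = z≤n
    hits+missed (x ∷ Γ) S with p x S
    ... | true  = s≤s (hits+missed Γ S)
    ... | false = ≤-trans (≤-reflexive (+-suc _ _)) (s≤s (hits+missed Γ S))

  -- Greedy: by averaging some S hits a 1/(1+D) fraction of the remaining
  -- list, so k rounds leave at most a (D/(1+D))^k fraction of it.
  greedy-hitting : ∀ D k Γ → (∀ {x} → x ∈ˡ Γ → (a + c) ^ n ≤ suc D * wsum a c ⊤ (𝟙 ∘ p x)) →
                   length Γ * D ^ k < suc D ^ k →
                   ∃ λ (F : Fin k → Subset n) → ∀ {x} → x ∈ˡ Γ → ∃ λ j → p x (F j) ≡ true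
  greedy-hitting D zero    []      heavy small = (λ ()) , λ ()
  greedy-hitting D zero    (x ∷ Γ) heavy (s≤s ())
  greedy-hitting D (suc k) Γ       heavy small = F , F-hits
    where
    S = proj₁ (wsum-max a c ⊤ (hits Γ))
    Γ′ = filter (missed? S) Γ
    many-hit : length Γ ≤ suc D * hits Γ S
    many-hit = *-cancelʳ-≤ _ _ ((a + c) ^ n) {{m^n≢0 (a + c) n}} (begin
      length Γ * (a + c) ^ n               ≤⟨ wsum-hits (suc D) Γ heavy ⟩
      suc D * wsum a c ⊤ (hits Γ)          ≤⟨ *-monoʳ-≤ (suc D) (proj₂ (wsum-max a c ⊤ (hits Γ))) ⟩
      suc D * (hits Γ S * (a + c) ^ ∣ ⊤ {n} ∣) ≡⟨ cong (λ w → suc D * (hits Γ S * (a + c) ^ w)) (∣⊤∣≡n n) ⟩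
      suc D * (hits Γ S * (a + c) ^ n)     ≡⟨ *-assoc (suc D) (hits Γ S) _ ⟨
      suc D * hits Γ S * (a + c) ^ n       ∎)
    few-missed : suc D * length Γ′ ≤ D * length Γ
    few-missed = +-cancelˡ-≤ (suc D * hits Γ S) _ _ (begin
      suc D * hits Γ S + suc D * length Γ′ ≡⟨ *-distribˡ-+ (suc D) (hits Γ S) (length Γ′) ⟨
      suc D * (hits Γ S + length Γ′)       ≤⟨ *-monoʳ-≤ (suc D) (hits+missed Γ S) ⟩
      length Γ + D * length Γ              ≤⟨ +-monoˡ-≤ (D * length Γ) many-hit ⟩
      suc D * hits Γ S + D * length Γ      ∎)
    small′ : length Γ′ * D ^ k < suc D ^ k
    small′ = *-cancelˡ-< (suc D) _ _ (begin-strict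
      suc D * (length Γ′ * D ^ k)   ≡⟨ *-assoc (suc D) (length Γ′) (D ^ k) ⟨
      suc D * length Γ′ * D ^ k     ≤⟨ *-monoˡ-≤ (D ^ k) few-missed ⟩
      D * length Γ * D ^ k          ≡⟨ eq D (length Γ) (D ^ k) ⟩
      length Γ * (D * D ^ k)        <⟨ small ⟩
      suc D * suc D ^ k             ∎)
      where
      eq : ∀ D l q → D * l * q ≡ l * (D * q)
      eq = solve-∀
    rest = greedy-hitting D k Γ′ (heavy ∘ proj₁ ∘ ∈-filter⁻ (missed? S)) small′
    F : Fin (suc k) → Subset n
    F zero    = S
    F (suc j) = proj₁ rest j
    F-hits : ∀ {x} → x ∈ˡ Γ → ∃ λ j → p x (F j) ≡ true
    F-hits {x} x∈Γ with p x S in eq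
    ... | true  = zero , eq
    ... | false with j , hit ← proj₂ rest (∈-filter⁺ (missed? S) x∈Γ eq) = suc j , hit

-- Enumeration of all instances

allVecs : ∀ {X : Set} → List X → ∀ k → List (Vec X k)
allVecs xs zero    = [] ∷ []
allVecs xs (suc k) = cartesianProductWith _∷_ xs (allVecs xs k)

length-cartesianProductWith : ∀ {X Y Z : Set} (f : X → Y → Z) xs ys →
                              length (cartesianProductWith f xs ys) ≡ length xs * length ys
length-cartesianProductWith f []       ys = refl
length-cartesianProductWith f (x ∷ xs) ys =
  trans (length-++ (List.map (f x) ys)) (cong₂ _+_ (length-map (f x) ys) (length-cartesianProductWith f xs ys))

length-allVecs : ∀ {X : Set} (xs : List X) k → length (allVecs xs k) ≡ length xs ^ k
length-allVecs xs zero    = refl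
length-allVecs xs (suc k) = trans (length-cartesianProductWith _∷_ xs _) (cong (length xs *_) (length-allVecs xs k))

∈-allVecs : ∀ {X : Set} {xs : List X} {k} (v : Vec X k) → (∀ i → lookup v i ∈ˡ xs) → v ∈ˡ allVecs xs k
∈-allVecs []      v∈xs = here refl
∈-allVecs (x ∷ v) v∈xs = ∈-cartesianProductWith⁺ _∷_ (v∈xs zero) (∈-allVecs v (v∈xs ∘ suc))

allSubsets : ∀ n → List (Subset n)
allSubsets = allVecs (inside ∷ outside ∷ [])

∈-allSubsets : ∀ {n} (S : Subset n) → S ∈ˡ allSubsets n
∈-allSubsets S = ∈-allVecs S λ i → ∈-sides (lookup S i)
  where
  ∈-sides : ∀ s → s ∈ˡ inside ∷ outside ∷ []
  ∈-sides inside  = here refl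
  ∈-sides outside = there (here refl)

over : ∀ {n} → ℕ → Subset n → Bool
over b S = ⌊ b <? ∣ S ∣ ⌋

-- Independence read off a list of parts. The list will be indexed by elements, because the number
-- of parts of a matroid is unbounded (parts may be empty) and the instances have to be enumerated.
independentᵇ : ∀ {n k} → Vec (Subset n × ℕ) k → Subset n → Bool
independentᵇ P S = ⌊ all? (λ e → ∣ S ∩ proj₁ (lookup P e) ∣ ≤? proj₂ (lookup P e)) ⌋

-- A part with its budget, then for each element its part and budget, then
-- the set of elements not yet removed.
Instance : ℕ → Set
Instance n = Vec (Subset n × ℕ) (suc n) × Subset n

-- The two conditions look at S inside and outside A respectively, so that their probabilities
-- multiply. The first leaves out U because it is applied to parts that lie within U.
isolates : ∀ {n} → Instance n → Subset n → Bool
isolates ((A , b) ∷ P , U) S = over b (S ∩ A) ∧ independentᵇ P ((S ∩ ∁ A) ∩ U)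

-- Tuples that come from no partition matroid are included as well; which of them a family must
-- serve is decided by their weight alone.
allInstances : ∀ n → List (Instance n)
allInstances n = cartesianProduct (allVecs (cartesianProduct (allSubsets n) (upTo (suc n))) (suc n)) (allSubsets n)

∈-allInstances : ∀ {n} (P : Vec (Subset n × ℕ) (suc n)) U → (∀ e → proj₂ (lookup P e) ≤ n) → (P , U) ∈ˡ allInstances n
∈-allInstances P U b≤n = ∈-cartesianProduct⁺
  (∈-allVecs P λ e → ∈-cartesianProduct⁺ (∈-allSubsets _) (∈-upTo⁺ (s≤s (b≤n e)))) (∈-allSubsets U)

n<2^n : ∀ n → n < 2 ^ n
n<2^n zero    = s≤s z≤n
n<2^n (suc n) = +-mono-≤ (m^n>0 2 n) (≤-trans (n<2^n n) (m≤m+n (2 ^ n) 0))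

-- n + n bits for a set with its budget, `suc n` such pairs, and n bits for the set of remaining
-- elements; one more bit makes the count strict.
instanceBits : ℕ → ℕ
instanceBits n = suc ((n + n) * suc n + n)

length-allInstances : ∀ n → length (allInstances n) < 2 ^ instanceBits n
length-allInstances n = begin-strict
  length (allInstances n)          ≡⟨ trans (length-cartesianProductWith _,_ (allVecs pairs (suc n)) (allSubsets n)) (cong₂ _*_ (length-allVecs pairs (suc n)) (length-allVecs _ n)) ⟩
  length pairs ^ suc n * 2 ^ n     ≤⟨ *-monoˡ-≤ (2 ^ n) (^-monoˡ-≤ (suc n) pairs≤) ⟩
  (2 ^ (n + n)) ^ suc n * 2 ^ n    ≡⟨ cong (_* 2 ^ n) (^-*-assoc 2 (n + n) (suc n)) ⟩
  2 ^ ((n + n) * suc n) * 2 ^ n    ≡⟨ ^-distribˡ-+-* 2 ((n + n) * suc n) n ⟨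
  2 ^ ((n + n) * suc n + n)        <⟨ ^-monoʳ-< 2 (s≤s (s≤s z≤n)) (n<1+n ((n + n) * suc n + n)) ⟩
  2 ^ instanceBits n               ∎
  where
  pairs = cartesianProduct (allSubsets n) (upTo (suc n))
  pairs≤ : length pairs ≤ 2 ^ (n + n)
  pairs≤ = begin
    length pairs      ≡⟨ trans (length-cartesianProductWith _,_ (allSubsets n) (upTo (suc n))) (cong₂ _*_ (length-allVecs _ n) (length-upTo (suc n))) ⟩
    2 ^ n * suc n     ≤⟨ *-monoʳ-≤ (2 ^ n) (n<2^n n) ⟩
    2 ^ n * 2 ^ n     ≡⟨ ^-distribˡ-+-* 2 n n ⟨
    2 ^ (n + n)       ∎

-- D greedy choices at least halve the instances not yet served, hence D choices per bit.
familySize : ℕ → ℕ → ℕ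
familySize n D = D * instanceBits n

module _ (n a c D : ℕ) .{{_ : NonZero (a + c)}} .{{_ : NonZero D}} where

  private
    Heavy : Instance n → Set
    Heavy I = (a + c) ^ n ≤ suc D * wsum a c ⊤ (𝟙 ∘ isolates I)

    heavy? : Decidable Heavy
    heavy? I = _ ≤? _

    few : length (filter heavy? (allInstances n)) * D ^ familySize n D < suc D ^ familySize n D
    few = begin-strict
      length (filter heavy? (allInstances n)) * D ^ (D * N)
                              <⟨ *-monoˡ-< (D ^ (D * N)) {{m^n≢0 D (D * N)}} (≤-<-trans (length-filter heavy? (allInstances n)) (length-allInstances n)) ⟩
      2 ^ N * D ^ (D * N)     ≡⟨ cong (2 ^ N *_) (^-*-assoc D D N) ⟨
      2 ^ N * (D ^ D) ^ N     ≡⟨ ^-distribʳ-* 2 (D ^ D) N ⟨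
      (2 * D ^ D) ^ N         ≤⟨ ^-monoˡ-≤ N (2*x^x≤[1+x]^x D) ⟩
      (suc D ^ D) ^ N         ≡⟨ ^-*-assoc (suc D) D N ⟩
      suc D ^ (D * N)         ∎
      where N = instanceBits n

  abstract
    -- The family depends on n, the weights and D only. This is what lets the sets be fixed before
    -- anything is known about the matroid.
    isolating-family : ∃ λ (F : Fin (familySize n D) → Subset n) →
                       ∀ {I} → I ∈ˡ allInstances n → Heavy I → ∃ λ j → isolates I (F j) ≡ true
    isolating-family =
      let F , hit = greedy-hitting a c isolates D (familySize n D) (filter heavy? (allInstances n))
                      (proj₂ ∘ ∈-filter⁻ heavy? {xs = allInstances n}) few
      in F , λ I∈ heavy → hit (∈-filter⁺ heavy? I∈ heavy)

-- The query strategy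

infix 4 _∥_

_∥_ : ∀ {n} → Subset n → Subset n → Set
p ∥ q = ∀ {x} → x ∈ p → x ∉ q

∣p∪q∣≤∣p∣+∣q∣ : ∀ {n} (p q : Subset n) → ∣ p ∪ q ∣ ≤ ∣ p ∣ + ∣ q ∣
∣p∪q∣≤∣p∣+∣q∣ []            []            = z≤n
∣p∪q∣≤∣p∣+∣q∣ (inside ∷ p)  (inside ∷ q)  = s≤s (≤-trans (∣p∪q∣≤∣p∣+∣q∣ p q) (+-monoʳ-≤ ∣ p ∣ (n≤1+n _)))
∣p∪q∣≤∣p∣+∣q∣ (inside ∷ p)  (outside ∷ q) = s≤s (∣p∪q∣≤∣p∣+∣q∣ p q)
∣p∪q∣≤∣p∣+∣q∣ (outside ∷ p) (inside ∷ q)  = ≤-trans (s≤s (∣p∪q∣≤∣p∣+∣q∣ p q)) (≤-reflexive (sym (+-suc _ _)))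
∣p∪q∣≤∣p∣+∣q∣ (outside ∷ p) (outside ∷ q) = ∣p∪q∣≤∣p∣+∣q∣ p q

∥⇒∣p∪q∣≡∣p∣+∣q∣ : ∀ {n} (p q : Subset n) → p ∥ q → ∣ p ∪ q ∣ ≡ ∣ p ∣ + ∣ q ∣
∥⇒∣p∪q∣≡∣p∣+∣q∣ []            []            p∥q = refl
∥⇒∣p∪q∣≡∣p∣+∣q∣ (inside ∷ p)  (inside ∷ q)  p∥q = contradiction here (p∥q here)
∥⇒∣p∪q∣≡∣p∣+∣q∣ (inside ∷ p)  (outside ∷ q) p∥q = cong suc (∥⇒∣p∪q∣≡∣p∣+∣q∣ p q λ x∈p x∈q → p∥q (there x∈p) (there x∈q))
∥⇒∣p∪q∣≡∣p∣+∣q∣ (outside ∷ p) (inside ∷ q)  p∥q = trans (cong suc (∥⇒∣p∪q∣≡∣p∣+∣q∣ p q λ x∈p x∈q → p∥q (there x∈p) (there x∈q))) (sym (+-suc _ _))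
∥⇒∣p∪q∣≡∣p∣+∣q∣ (outside ∷ p) (outside ∷ q) p∥q = ∥⇒∣p∪q∣≡∣p∣+∣q∣ p q λ x∈p x∈q → p∥q (there x∈p) (there x∈q)

∣p∣≤1+∣q∣ : ∀ {n} {p q : Subset n} x → p ⊆ q ∪ ⁅ x ⁆ → ∣ p ∣ ≤ suc ∣ q ∣
∣p∣≤1+∣q∣ {p = p} {q} x p⊆ = begin
  ∣ p ∣              ≤⟨ p⊆q⇒∣p∣≤∣q∣ p⊆ ⟩
  ∣ q ∪ ⁅ x ⁆ ∣      ≤⟨ ∣p∪q∣≤∣p∣+∣q∣ q ⁅ x ⁆ ⟩
  ∣ q ∣ + ∣ ⁅ x ⁆ ∣  ≡⟨ cong (∣ q ∣ +_) (∣⁅x⁆∣≡1 x) ⟩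
  ∣ q ∣ + 1          ≡⟨ +-comm ∣ q ∣ 1 ⟩
  suc ∣ q ∣          ∎

⊆∧∉⇒∣p∣<∣q∣ : ∀ {n} {p q : Subset n} {x} → p ⊆ q → x ∈ q → x ∉ p → ∣ p ∣ < ∣ q ∣
⊆∧∉⇒∣p∣<∣q∣ p⊆q x∈q x∉p = p⊂q⇒∣p∣<∣q∣ (p⊆q , _ , x∈q , x∉p)

∣∣-cong : ∀ {n} {p q : Subset n} → p ⊆ q → q ⊆ p → ∣ p ∣ ≡ ∣ q ∣
∣∣-cong p⊆q q⊆p = ≤-antisym (p⊆q⇒∣p∣≤∣q∣ p⊆q) (p⊆q⇒∣p∣≤∣q∣ q⊆p)

∩-monoˡ : ∀ {n} {p q r : Subset n} → p ⊆ q → p ∩ r ⊆ q ∩ r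
∩-monoˡ {p = p} {r = r} p⊆q x∈ with x∈p , x∈r ← x∈p∩q⁻ p r x∈ = x∈p∩q⁺ (p⊆q x∈p , x∈r)

∥⇒∣p∩q∣≡0 : ∀ {n} {p q : Subset n} → p ∥ q → ∣ p ∩ q ∣ ≡ 0
∥⇒∣p∩q∣≡0 {n} {p} {q} p∥q = trans (cong ∣_∣ (Empty-unique λ (x , x∈) → uncurry p∥q (x∈p∩q⁻ p q x∈))) (∣⊥∣≡0 n)

∣p∩q∣≡0⇒∥ : ∀ {n} {p q : Subset n} → ∣ p ∩ q ∣ ≡ 0 → p ∥ q
∣p∩q∣≡0⇒∥ {p = p} {q} ≡0 {x} x∈p x∈q = contradiction (subst (1 ≤_) ≡0 (≤-trans (≤-reflexive (sym (∣⁅x⁆∣≡1 x))) (p⊆q⇒∣p∣≤∣q∣ ⁅x⁆⊆))) λ ()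
  where
  ⁅x⁆⊆ : ⁅ x ⁆ ⊆ p ∩ q
  ⁅x⁆⊆ y∈ with refl ← x∈⁅y⁆⇒x≡y x y∈ = x∈p∩q⁺ (x∈p , x∈q)

-- Turns a circuit of b + 1 elements into b independent ones, and keeps the empty set, so that an
-- unsuccessful candidate contributes nothing.
dropFirst : ∀ {n} → Subset n → Subset n
dropFirst []            = []
dropFirst (inside ∷ p)  = outside ∷ p
dropFirst (outside ∷ p) = outside ∷ dropFirst p

dropFirst-⊆ : ∀ {n} (p : Subset n) → dropFirst p ⊆ p
dropFirst-⊆ (inside ∷ p)  (there x∈) = there x∈
dropFirst-⊆ (outside ∷ p) (there x∈) = there (dropFirst-⊆ p x∈)

∣dropFirst∣ : ∀ {n} (p : Subset n) → ∣ dropFirst p ∣ ≡ pred ∣ p ∣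
∣dropFirst∣ []            = refl
∣dropFirst∣ (inside ∷ p)  = refl
∣dropFirst∣ (outside ∷ p) = ∣dropFirst∣ p

prefix : ∀ {n} → Fin (suc n) → Subset n
prefix zero            = ⊥
prefix {suc n} (suc l) = inside ∷ prefix l

-- A discrete intermediate value argument: lengthening the prefix by one element adds at most one to
-- the intersection.
prefix-of-size : ∀ {n} (p : Subset n) k → k ≤ ∣ p ∣ → ∃ λ l → ∣ p ∩ prefix l ∣ ≡ k
prefix-of-size []            zero    k≤   = zero , refl
prefix-of-size (s ∷ p)       zero    k≤   = zero , ∥⇒∣p∩q∣≡0 {p = s ∷ p} {⊥} λ _ → ∉⊥
prefix-of-size (inside ∷ p)  (suc k) (s≤s k≤) with l , eq ← prefix-of-size p k k≤ = suc l , cong suc eq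
prefix-of-size (outside ∷ p) (suc k) k≤ with l , eq ← prefix-of-size p (suc k) k≤ = suc l , eq

∈-tabulate⁺ : ∀ {n} (f : Fin n → Bool) {x} → f x ≡ true → x ∈ tabulate f
∈-tabulate⁺ f {x} fx = lookup⇒[]= x _ (trans (lookup∘tabulate f x) fx)

∈-tabulate⁻ : ∀ {n} (f : Fin n → Bool) {x} → x ∈ tabulate f → f x ≡ true
∈-tabulate⁻ f {x} x∈ = trans (sym (lookup∘tabulate f x)) ([]=⇒lookup x∈)

flatten : ∀ {p q} {X : Set} → (Fin p → Fin q → X) → Fin (p * q) → X
flatten {q = q} f i = uncurry f (remQuot q i)

flatten-combine : ∀ {p q} {X : Set} (f : Fin p → Fin q → X) i j → flatten f (combine i j) ≡ f i j
flatten-combine f i j = cong (uncurry f) (remQuot-combine i j)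

module Strategy (n q : ℕ) (Y : Fin q → Subset n) where

  -- The union of the remaining parts, and a basis of the removed ones.
  State : Set
  State = Subset n × Subset n

  -- Index `zero` stands for X itself, so that one batch tests X together with all its single
  -- deletions.
  deletion : Subset n → Fin (suc n) → Subset n
  deletion X zero    = X
  deletion X (suc f) = X - f

  -- Empty unless X exceeds exactly one budget, and that by one element; then
  -- it is the intersection of X with the part in question.
  circuit : Subset n → (Fin (suc n) → Bool) → Subset n
  circuit X ans = tabulate λ f → lookup X f ∧ (not (ans zero) ∧ ans (suc f))

  -- If I meets each part in nothing or in its full budget, this is the union of the parts whose
  -- budget I fills: a few elements reveal the whole part. Parts of budget 0 count as filled.
  span : Subset n → (Fin n → Bool) → Subset n
  span I ans = tabulate λ f → lookup I f ∨ not (ans f)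

  deletions : Subset n → Vec (Subset n) (q * suc n)
  deletions U = tabulate (flatten λ x → deletion (Y x ∩ U))

  tightSets : Subset n → Vec Bool (q * suc n) → Fin q → Subset n
  tightSets U v x = dropFirst (circuit (Y x ∩ U) λ f → lookup v (combine x f))

  extensions : (Fin q → Subset n) → Vec (Subset n) (q * n)
  extensions I = tabulate (flatten λ x f → I x ∪ ⁅ f ⁆)

  spans : (Fin q → Subset n) → Vec Bool (q * n) → Fin q → Subset n
  spans I w x = span (I x) λ f → lookup w (combine x f)

  -- Several candidates may find the same part in one step. Intersecting with the current U keeps
  -- the later ones from adding to B again.
  remove : Subset n → Subset n → State → State
  remove I D (U , B) = U ∩ ∁ D , B ∪ (I ∩ U)

  removeAll : ∀ {k} → (I D : Fin k → Subset n) → State → State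
  removeAll {zero}  I D st = st
  removeAll {suc k} I D st = removeAll (I ∘ suc) (D ∘ suc) (remove (I zero) (D zero) st)

  -- An iteration takes two rounds, since the extensions depend on the answers about deletions. The
  -- final union is a basis as soon as U has become independent.
  strategy : ℕ → State → Algorithm n
  strategy zero    (U , B) = return (B ∪ U)
  strategy (suc k) (U , B) =
    ask (deletions U) λ v → let I = tightSets U v in
    ask (extensions I) λ w → strategy k (removeAll I (spans I w) (U , B))

  module _ (o : Subset n → Bool) where

    tight : Subset n → Fin q → Subset n
    tight U = tightSets U (map o (deletions U))

    tightSpan : Subset n → Fin q → Subset n
    tightSpan U = spans (tight U) (map o (extensions (tight U)))

    step : State → State
    step (U , B) = removeAll (tight U) (tightSpan U) (U , B)

    rounds-strategy : ∀ k st → rounds o (strategy k st) ≡ k + k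
    rounds-strategy zero    st = refl
    rounds-strategy (suc k) st = cong suc (trans (cong suc (rounds-strategy k (step st))) (sym (+-suc k k)))

    queries-strategy : ∀ k st → queries o (strategy k st) ≡ k * (q * suc n + q * n)
    queries-strategy zero    st = refl
    queries-strategy (suc k) st = trans (cong (λ w → q * suc n + (q * n + w)) (queries-strategy k (step st)))
                                        (sym (+-assoc (q * suc n) (q * n) _))

    answer : ∀ {k} (Q : Fin q → Fin k → Subset n) x f →
             lookup (map o (tabulate (flatten Q))) (combine x f) ≡ o (Q x f)
    answer Q x f = trans (lookup-map (combine x f) o (tabulate (flatten Q)))
      (cong o (trans (lookup∘tabulate (flatten Q) (combine x f)) (flatten-combine Q x f)))

  -- Correctness of a step on a partition matroid

  module _ (M : PartitionMatroid n) where
    open PartitionMatroid M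

    dependent⇒over : ∀ S → ¬ Independent S → ∃ λ i → b i < ∣ S ∩ A i ∣
    dependent⇒over S dep with i , ≰ ← ¬∀⟶∃¬ m _ (λ i → ∣ S ∩ A i ∣ ℕ.≤? b i) dep = i , ≰⇒> ≰

    oracle⁺ : ∀ S → Independent S → oracle S ≡ true
    oracle⁺ S ind = trans (isYes≗does (independent? S)) (dec-true (independent? S) ind)

    oracle⁻ : ∀ S → ¬ Independent S → oracle S ≡ false
    oracle⁻ S dep = trans (isYes≗does (independent? S)) (dec-false (independent? S) dep)

    part-unique : ∀ {e i j} → e ∈ A i → e ∈ A j → i ≡ j
    part-unique {e} {i} {j} e∈Ai e∈Aj = decidable-stable (i ≟ j) λ i≢j → disjoint i≢j (e , x∈p∩q⁺ (e∈Ai , e∈Aj))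

    -- The condition under which `span` returns a union of whole parts.
    Tight : Subset n → Set
    Tight I = ∀ j → ∣ I ∩ A j ∣ ≡ 0 ⊎ ∣ I ∩ A j ∣ ≡ b j

    -- The configuration that sampling has to produce: `X ∩ A i` is then the unique circuit of X.
    record OverOnlyAt (X : Subset n) (i : Fin m) : Set where
      field
        over-by-one : ∣ X ∩ A i ∣ ≡ suc (b i)
        elsewhere   : ∀ j → j ≢ i → ∣ X ∩ A j ∣ ≤ b j

    module _ (X : Subset n) (ans : Fin (suc n) → Bool) (ans≡ : ∀ f → ans f ≡ oracle (deletion X f)) where

      private
        C = circuit X ans

      ∈-circuit⁻ : ∀ {f} → f ∈ C → f ∈ X × ¬ Independent X × Independent (X - f)
      ∈-circuit⁻ {f} f∈C = split (trans (sym (cong₂ (λ u v → lookup X f ∧ (not u ∧ v)) (ans≡ zero) (ans≡ (suc f)))) (∈-tabulate⁻ _ f∈C))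
        where
        split : lookup X f ∧ (not (oracle X) ∧ oracle (X - f)) ≡ true → f ∈ X × ¬ Independent X × Independent (X - f)
        split eq with lookup X f in eqX | independent? X | independent? (X - f)
        ... | true | no dep | yes ind = lookup⇒[]= f X eqX , dep , ind

      ∈-circuit⁺ : ∀ {f} → f ∈ X → ¬ Independent X → Independent (X - f) → f ∈ C
      ∈-circuit⁺ {f} f∈X dep ind = ∈-tabulate⁺ _
        (cong₂ _∧_ ([]=⇒lookup f∈X) (cong₂ (λ u v → not u ∧ v) (trans (ans≡ zero) (oracle⁻ X dep)) (trans (ans≡ (suc f)) (oracle⁺ (X - f) ind))))

      -- Deleting an element of the overfull part brings it back to its budget; deleting any other
      -- element leaves the overflow in place.
      circuit≡part : ∀ {i} → OverOnlyAt X i → ∀ {f} → (f ∈ C → f ∈ X ∩ A i) × (f ∈ X ∩ A i → f ∈ C)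
      circuit≡part {i} record { over-by-one = eq ; elsewhere = elsewhere } {f} = to , from
        where
        to : f ∈ C → f ∈ X ∩ A i
        to f∈C with f∈X , dep , ind ← ∈-circuit⁻ f∈C with f ∈? A i
        ... | yes f∈A = x∈p∩q⁺ (f∈X , f∈A)
        ... | no  f∉A = contradiction (begin
            suc (b i)          ≡⟨ eq ⟨
            ∣ X ∩ A i ∣        ≤⟨ p⊆q⇒∣p∣≤∣q∣ keep ⟩
            ∣ (X - f) ∩ A i ∣  ≤⟨ ind i ⟩
            b i                ∎) (<-irrefl refl)
          where
          keep : X ∩ A i ⊆ (X - f) ∩ A i
          keep {x} x∈ with x∈X , x∈A ← x∈p∩q⁻ X (A i) x∈ = x∈p∩q⁺ (x∈p∧x≢y⇒x∈p-y x∈X (λ { refl → f∉A x∈A }) , x∈A)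
        from : f ∈ X ∩ A i → f ∈ C
        from f∈ = ∈-circuit⁺ f∈X (λ ind → <-irrefl refl (≤-trans (≤-reflexive (sym eq)) (ind i))) ind
          where
          f∈X = proj₁ (x∈p∩q⁻ X (A i) f∈)
          X-f⊆X : X - f ⊆ X
          X-f⊆X = p─q⊆p X ⁅ f ⁆
          ind : Independent (X - f)
          ind j with j ≟ i
          ... | no  j≢i  = ≤-trans (p⊆q⇒∣p∣≤∣q∣ (∩-monoˡ X-f⊆X)) (elsewhere j j≢i)
          ... | yes refl = s≤s⁻¹ (subst (∣ (X - f) ∩ A i ∣ <_) eq (⊆∧∉⇒∣p∣<∣q∣ (∩-monoˡ X-f⊆X) f∈
                             λ f∈′ → f∉X-f (proj₁ (x∈p∩q⁻ (X - f) (A i) f∈′))))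
            where
            f∉X-f : f ∉ X - f
            f∉X-f f∈X-f = contradiction (trans (sym ([]=⇒lookup f∈X-f)) (lookup-del X f)) λ ()
              where
              lookup-del : ∀ {n} (X : Subset n) f → lookup (X - f) f ≡ outside
              lookup-del (s ∷ X) zero    = refl
              lookup-del (s ∷ X) (suc f) = lookup-del X f

      tight-at : ∀ {i} → OverOnlyAt X i → ∣ dropFirst C ∩ A i ∣ ≡ b i
      tight-at {i} over = begin-equality
        ∣ dropFirst C ∩ A i ∣  ≡⟨ ∣∣-cong (p∩q⊆p _ _) (λ x∈ → x∈p∩q⁺ (x∈ , proj₂ (x∈p∩q⁻ X (A i) (proj₁ (circuit≡part over) (dropFirst-⊆ C x∈))))) ⟩
        ∣ dropFirst C ∣        ≡⟨ ∣dropFirst∣ C ⟩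
        pred ∣ C ∣             ≡⟨ cong pred (∣∣-cong (proj₁ (circuit≡part over)) (proj₂ (circuit≡part over))) ⟩
        pred ∣ X ∩ A i ∣       ≡⟨ cong pred (OverOnlyAt.over-by-one over) ⟩
        b i                    ∎

      -- Holds for every X, so candidates that isolate nothing do no harm: if some deletion makes X
      -- independent, then X exceeds one budget only, and by one.
      tight-everywhere : Tight (dropFirst C)
      tight-everywhere j with nonempty? C
      ... | no  empty    = inj₁ (∥⇒∣p∩q∣≡0 λ x∈ _ → empty (_ , dropFirst-⊆ C x∈))
      ... | yes (f , f∈C) with f∈X , dep , ind ← ∈-circuit⁻ f∈C with i , over ← dependent⇒over X dep = result
        where
        keep : ∀ {j} → f ∉ A j → X ∩ A j ⊆ (X - f) ∩ A j
        keep {j} f∉A x∈ with x∈X , x∈A ← x∈p∩q⁻ X (A j) x∈ = x∈p∩q⁺ (x∈p∧x≢y⇒x∈p-y x∈X (λ { refl → f∉A x∈A }) , x∈A)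
        f∈Ai : f ∈ A i
        f∈Ai = decidable-stable (f ∈? A i) λ f∉A → <⇒≱ over (≤-trans (p⊆q⇒∣p∣≤∣q∣ (keep f∉A)) (ind i))
        X∩A⊆ : X ∩ A i ⊆ ((X - f) ∩ A i) ∪ ⁅ f ⁆
        X∩A⊆ {x} x∈ with x∈X , x∈A ← x∈p∩q⁻ X (A i) x∈ with x ≟ f
        ... | yes refl = x∈p∪q⁺ (inj₂ (x∈⁅x⁆ x))
        ... | no  x≢f  = x∈p∪q⁺ (inj₁ (x∈p∩q⁺ (x∈p∧x≢y⇒x∈p-y x∈X x≢f , x∈A)))
        overOnly : OverOnlyAt X i
        overOnly = record
          { over-by-one = ≤-antisym (≤-trans (∣p∣≤1+∣q∣ f X∩A⊆) (s≤s (ind i))) over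
          ; elsewhere   = λ j j≢i → ≤-trans (p⊆q⇒∣p∣≤∣q∣ (keep λ f∈Aj → j≢i (part-unique f∈Aj f∈Ai))) (ind j)
          }
        result : ∣ dropFirst C ∩ A j ∣ ≡ 0 ⊎ ∣ dropFirst C ∩ A j ∣ ≡ b j
        result with j ≟ i
        ... | yes refl = inj₂ (tight-at overOnly)
        ... | no  j≢i  = inj₁ (∥⇒∣p∩q∣≡0 λ x∈C x∈Aj →
                j≢i (part-unique x∈Aj (proj₂ (x∈p∩q⁻ X (A i) (proj₁ (circuit≡part overOnly) (dropFirst-⊆ C x∈C))))))

    module _ (I : Subset n) (I-tight : Tight I) (ans : Fin n → Bool) (ans≡ : ∀ f → ans f ≡ oracle (I ∪ ⁅ f ⁆)) where

      ∈-span⁻ : ∀ {f} → f ∈ span I ans → f ∈ I ⊎ ¬ Independent (I ∪ ⁅ f ⁆)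
      ∈-span⁻ {f} f∈ = split (trans (sym (cong (λ u → lookup I f ∨ not u) (ans≡ f))) (∈-tabulate⁻ _ f∈))
        where
        split : lookup I f ∨ not (oracle (I ∪ ⁅ f ⁆)) ≡ true → f ∈ I ⊎ ¬ Independent (I ∪ ⁅ f ⁆)
        split eq with lookup I f in eqI | independent? (I ∪ ⁅ f ⁆)
        ... | true  | _      = inj₁ (lookup⇒[]= f I eqI)
        ... | false | no dep = inj₂ dep

      span-⊇ : I ⊆ span I ans
      span-⊇ {f} f∈I = ∈-tabulate⁺ _ (cong (_∨ not (ans f)) ([]=⇒lookup f∈I))

      span-⊇-part : ∀ {j} → ∣ I ∩ A j ∣ ≡ b j → A j ⊆ span I ans
      span-⊇-part {j} eq {f} f∈A with f ∈? I
      ... | yes f∈I = span-⊇ f∈I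
      ... | no  f∉I = ∈-tabulate⁺ _ (trans (cong (λ u → lookup I f ∨ not u) (trans (ans≡ f) (oracle⁻ (I ∪ ⁅ f ⁆) dep))) (∨-zeroʳ (lookup I f)))
        where
        dep : ¬ Independent (I ∪ ⁅ f ⁆)
        dep ind = <⇒≱ (subst (_< ∣ (I ∪ ⁅ f ⁆) ∩ A j ∣) eq
          (⊆∧∉⇒∣p∣<∣q∣ (∩-monoˡ (p⊆p∪q ⁅ f ⁆)) (x∈p∩q⁺ (x∈p∪q⁺ (inj₂ (x∈⁅x⁆ f)) , f∈A)) λ f∈ → f∉I (proj₁ (x∈p∩q⁻ I (A j) f∈)))) (ind j)

      -- By tightness I misses such a part, whose budget is therefore positive, and so every element
      -- of the part can be added to I.
      span-∥-part : ∀ {j} → ∣ I ∩ A j ∣ ≢ b j → span I ans ∥ A j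
      span-∥-part {j} ≢b {f} f∈ f∈A = [ (λ f∈I → ∣p∩q∣≡0⇒∥ ≡0 f∈I f∈A) , (λ dep → dep ind) ]′ (∈-span⁻ f∈)
        where
        ≡0 : ∣ I ∩ A j ∣ ≡ 0
        ≡0 = [ (λ z → z) , (λ eq → contradiction eq ≢b) ]′ (I-tight j)
        b≢0 : 1 ≤ b j
        b≢0 = n≢0⇒n>0 λ b≡0 → ≢b (trans ≡0 (sym b≡0))
        I≤b : ∀ i → ∣ I ∩ A i ∣ ≤ b i
        I≤b i with I-tight i
        ... | inj₁ eq = ≤-trans (≤-reflexive eq) z≤n
        ... | inj₂ eq = ≤-reflexive eq
        drop : ∀ {i} → f ∉ A i → (I ∪ ⁅ f ⁆) ∩ A i ⊆ I ∩ A i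
        drop {i} f∉A {x} x∈ with x∈I∪f , x∈A ← x∈p∩q⁻ (I ∪ ⁅ f ⁆) (A i) x∈ with x∈p∪q⁻ I ⁅ f ⁆ x∈I∪f
        ... | inj₁ x∈I = x∈p∩q⁺ (x∈I , x∈A)
        ... | inj₂ x∈f with refl ← x∈⁅y⁆⇒x≡y f x∈f = contradiction x∈A f∉A
        shrink : (I ∪ ⁅ f ⁆) ∩ A j ⊆ (I ∩ A j) ∪ ⁅ f ⁆
        shrink {x} x∈ with x∈I∪f , x∈A ← x∈p∩q⁻ (I ∪ ⁅ f ⁆) (A j) x∈ with x∈p∪q⁻ I ⁅ f ⁆ x∈I∪f
        ... | inj₁ x∈I = x∈p∪q⁺ (inj₁ (x∈p∩q⁺ (x∈I , x∈A)))
        ... | inj₂ x∈f = x∈p∪q⁺ (inj₂ x∈f)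
        ind : Independent (I ∪ ⁅ f ⁆)
        ind i with i ≟ j
        ... | yes refl = ≤-trans (∣p∣≤1+∣q∣ f shrink) (≤-trans (s≤s (≤-reflexive ≡0)) b≢0)
        ... | no  i≢j  = ≤-trans (p⊆q⇒∣p∣≤∣q∣ (drop λ f∈Ai → i≢j (part-unique f∈Ai f∈A))) (I≤b i)

    -- A part is either untouched or finished. As no part is ever taken partially, answers on
    -- subsets of U need no correction by B.
    PartStatus : State → Fin m → Set
    PartStatus (U , B) j = (A j ⊆ U × B ∥ A j) ⊎ (U ∥ A j × ∣ B ∩ A j ∣ ≡ b j)

    Invariant : State → Set
    Invariant st = ∀ j → PartStatus st j

    Removable : Subset n → Subset n → Set
    Removable I D = I ⊆ D × ∀ j → (A j ⊆ D × ∣ I ∩ A j ∣ ≡ b j) ⊎ D ∥ A j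

    remove-invariant : ∀ {I D st} → Removable I D → Invariant st → Invariant (remove I D st)
    remove-invariant {I} {D} {U , B} (I⊆D , D-parts) inv j with inv j | D-parts j
    ... | inj₁ (A⊆U , B∥A) | inj₁ (A⊆D , I≡b) = inj₂
      ( (λ x∈ x∈A → x∈∁p⇒x∉p (proj₂ (x∈p∩q⁻ U (∁ D) x∈)) (A⊆D x∈A))
      , trans (∣∣-cong to from) I≡b )
      where
      to : (B ∪ (I ∩ U)) ∩ A j ⊆ I ∩ A j
      to x∈ with x∈B∪ , x∈A ← x∈p∩q⁻ (B ∪ (I ∩ U)) (A j) x∈ with x∈p∪q⁻ B (I ∩ U) x∈B∪
      ... | inj₁ x∈B = contradiction x∈A (B∥A x∈B)
      ... | inj₂ x∈I = x∈p∩q⁺ (proj₁ (x∈p∩q⁻ I U x∈I) , x∈A)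
      from : I ∩ A j ⊆ (B ∪ (I ∩ U)) ∩ A j
      from x∈ with x∈I , x∈A ← x∈p∩q⁻ I (A j) x∈ = x∈p∩q⁺ (x∈p∪q⁺ (inj₂ (x∈p∩q⁺ (x∈I , A⊆U x∈A))) , x∈A)
    ... | inj₁ (A⊆U , B∥A) | inj₂ D∥A = inj₁
      ( (λ x∈A → x∈p∩q⁺ (A⊆U x∈A , x∉p⇒x∈∁p λ x∈D → D∥A x∈D x∈A))
      , λ x∈ x∈A → [ (λ x∈B → B∥A x∈B x∈A) , (λ x∈I → D∥A (I⊆D (proj₁ (x∈p∩q⁻ I U x∈I))) x∈A) ]′ (x∈p∪q⁻ B (I ∩ U) x∈) )
    -- The part was finished before, possibly by an earlier candidate of the same step; `I ∩ U` does
    -- not meet it.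
    ... | inj₂ (U∥A , B≡b) | _ = inj₂
      ( (λ x∈ x∈A → U∥A (proj₁ (x∈p∩q⁻ U (∁ D) x∈)) x∈A)
      , trans (∣∣-cong to (∩-monoˡ (p⊆p∪q (I ∩ U)))) B≡b )
      where
      to : (B ∪ (I ∩ U)) ∩ A j ⊆ B ∩ A j
      to x∈ with x∈B∪ , x∈A ← x∈p∩q⁻ (B ∪ (I ∩ U)) (A j) x∈ with x∈p∪q⁻ B (I ∩ U) x∈B∪
      ... | inj₁ x∈B = x∈p∩q⁺ (x∈B , x∈A)
      ... | inj₂ x∈I = contradiction x∈A (U∥A (proj₂ (x∈p∩q⁻ I U x∈I)))

    removeAll-invariant : ∀ {k} {I D : Fin k → Subset n} {st} → (∀ x → Removable (I x) (D x)) → Invariant st →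
                          Invariant (removeAll I D st)
    removeAll-invariant {zero}  rem inv = inv
    removeAll-invariant {suc k} rem inv = removeAll-invariant (rem ∘ suc) (remove-invariant (rem zero) inv)

    removeAll-⊆ : ∀ {k} (I D : Fin k → Subset n) st → proj₁ (removeAll I D st) ⊆ proj₁ st
    removeAll-⊆ {zero}  I D st x∈ = x∈
    removeAll-⊆ {suc k} I D st x∈ = p∩q⊆p _ _ (removeAll-⊆ (I ∘ suc) (D ∘ suc) (remove (I zero) (D zero) st) x∈)

    removeAll-∥ : ∀ {k} (I D : Fin k → Subset n) st x → proj₁ (removeAll I D st) ∥ D x
    removeAll-∥ {suc k} I D st zero    y∈ = x∈∁p⇒x∉p (p∩q⊆q (proj₁ st) _ (removeAll-⊆ (I ∘ suc) (D ∘ suc) (remove (I zero) (D zero) st) y∈))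
    removeAll-∥ {suc k} I D st (suc x) y∈ = removeAll-∥ (I ∘ suc) (D ∘ suc) (remove (I zero) (D zero) st) x y∈

    module _ (U : Subset n) where

      private
        I = tight oracle U
        D = tightSpan oracle U
        ans₁≡ : ∀ x f → _ ≡ oracle (deletion (Y x ∩ U) f)
        ans₁≡ = answer oracle (λ x → deletion (Y x ∩ U))
        ans₂≡ : ∀ x f → _ ≡ oracle (I x ∪ ⁅ f ⁆)
        ans₂≡ = answer oracle (λ x f → I x ∪ ⁅ f ⁆)
        I-tight : ∀ x → Tight (I x)
        I-tight x = tight-everywhere (Y x ∩ U) _ (ans₁≡ x)

      step-removable : ∀ x → Removable (I x) (D x)
      step-removable x = span-⊇ (I x) (I-tight x) _ (ans₂≡ x) , parts
        where
        parts : ∀ j → (A j ⊆ D x × ∣ I x ∩ A j ∣ ≡ b j) ⊎ D x ∥ A j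
        parts j with ∣ I x ∩ A j ∣ ℕ.≟ b j
        ... | yes ≡b = inj₁ (span-⊇-part (I x) (I-tight x) _ (ans₂≡ x) ≡b , ≡b)
        ... | no  ≢b = inj₂ (span-∥-part (I x) (I-tight x) _ (ans₂≡ x) ≢b)

      step-removes : ∀ {i} B x → OverOnlyAt (Y x ∩ U) i → proj₁ (step oracle (U , B)) ∥ A i
      step-removes B x over y∈ y∈A = removeAll-∥ I D (U , B) x y∈
        (span-⊇-part (I x) (I-tight x) _ (ans₂≡ x) (tight-at (Y x ∩ U) _ (ans₁≡ x) over) y∈A)

    step-invariant : ∀ {st} → Invariant st → Invariant (step oracle st)
    step-invariant {U , B} = removeAll-invariant (step-removable U)

    step-⊆ : ∀ st → proj₁ (step oracle st) ⊆ proj₁ st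
    step-⊆ (U , B) = removeAll-⊆ (tight oracle U) (tightSpan oracle U) (U , B)

    -- An element outside `B ∪ U` lies in a finished part, whose budget B already fills.
    invariant⇒basis : ∀ {U B} → Invariant (U , B) → Independent U → IsBasis (B ∪ U)
    invariant⇒basis {U} {B} inv ind = independent , maximal
      where
      independent : Independent (B ∪ U)
      independent j with inv j
      ... | inj₁ (_ , B∥A) = ≤-trans (p⊆q⇒∣p∣≤∣q∣ to) (ind j)
        where
        to : (B ∪ U) ∩ A j ⊆ U ∩ A j
        to x∈ with x∈B∪U , x∈A ← x∈p∩q⁻ (B ∪ U) (A j) x∈ with x∈p∪q⁻ B U x∈B∪U
        ... | inj₁ x∈B = contradiction x∈A (B∥A x∈B)
        ... | inj₂ x∈U = x∈p∩q⁺ (x∈U , x∈A)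
      ... | inj₂ (U∥A , B≡b) = ≤-trans (p⊆q⇒∣p∣≤∣q∣ to) (≤-reflexive B≡b)
        where
        to : (B ∪ U) ∩ A j ⊆ B ∩ A j
        to x∈ with x∈B∪U , x∈A ← x∈p∩q⁻ (B ∪ U) (A j) x∈ with x∈p∪q⁻ B U x∈B∪U
        ... | inj₁ x∈B = x∈p∩q⁺ (x∈B , x∈A)
        ... | inj₂ x∈U = contradiction x∈A (U∥A x∈U)
      maximal : ∀ {S} → B ∪ U ⊂ S → ¬ Independent S
      maximal {S} (B∪U⊆S , e , e∈S , e∉) S-ind with j , e∈A ← cover e with inv j
      ... | inj₁ (A⊆U , _)   = e∉ (x∈p∪q⁺ (inj₂ (A⊆U e∈A)))
      ... | inj₂ (_ , B≡b) = <⇒≱ (subst (_< ∣ S ∩ A j ∣) B≡b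
              (⊆∧∉⇒∣p∣<∣q∣ (∩-monoˡ (B∪U⊆S ∘ p⊆p∪q U)) (x∈p∩q⁺ (e∈S , e∈A)) λ e∈ → e∉ (x∈p∪q⁺ (inj₁ (proj₁ (x∈p∩q⁻ B (A j) e∈)))))) (S-ind j)

    record Solves (k : ℕ) (st : State) : Set where
      constructor solves
      field
        basis : IsBasis (output oracle (strategy k st))

    solves-after-step : ∀ k st → Solves k (step oracle st) → Solves (suc k) st
    solves-after-step k st (solves basis) = solves basis

    -- Surplus iterations are harmless, because U only shrinks and thus stays independent.
    solves-independent : ∀ k st → Invariant st → Independent (proj₁ st) → Solves k st
    solves-independent zero    st inv ind = solves (invariant⇒basis inv ind)
    solves-independent (suc k) st inv ind = solves-after-step k st
      (solves-independent k (step oracle st) (step-invariant inv) λ j → ≤-trans (p⊆q⇒∣p∣≤∣q∣ (∩-monoˡ (step-⊆ st))) (ind j))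

-- Isolating one part by sampling

over⁺ : ∀ {n} b (S : Subset n) → b < ∣ S ∣ → over b S ≡ true
over⁺ b S b< = trans (isYes≗does (b <? ∣ S ∣)) (dec-true (b <? ∣ S ∣) b<)

over⁻ : ∀ {n} b (S : Subset n) → over b S ≡ true → b < ∣ S ∣
over⁻ b S eq with yes b< ← b <? ∣ S ∣ = b<

¬over : ∀ {n} b (S : Subset n) → ∣ S ∣ ≤ b → over b S ≡ false
¬over b S ≤b = trans (isYes≗does (b <? ∣ S ∣)) (dec-false (b <? ∣ S ∣) (≤⇒≯ ≤b))

over-mono : ∀ {n} b {S S′ : Subset n} → S ⊆ S′ → 𝟙 (over b S) ≤ 𝟙 (over b S′)
over-mono b {S} {S′} S⊆S′ with b <? ∣ S ∣
... | no  _  = z≤n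
... | yes b< rewrite over⁺ b S′ (≤-trans b< (p⊆q⇒∣p∣≤∣q∣ S⊆S′)) = ≤-refl

x≤sum : ∀ {k} (f : Fin k → ℕ) i → f i ≤ Vec.sum (tabulate f)
x≤sum f zero    = m≤m+n _ _
x≤sum f (suc i) = ≤-trans (x≤sum (f ∘ suc) i) (m≤n+m _ (f zero))

independentᵇ⁻ : ∀ {n k} (P : Vec (Subset n × ℕ) k) S → independentᵇ P S ≡ true →
                ∀ e → ∣ S ∩ proj₁ (lookup P e) ∣ ≤ proj₂ (lookup P e)
independentᵇ⁻ P S eq with yes ind ← all? (λ e → ∣ S ∩ proj₁ (lookup P e) ∣ ℕ.≤? proj₂ (lookup P e)) = ind

-- The union bound, pointwise.
1≤independent+over : ∀ {n k} (A : Fin k → Subset n) (b : Fin k → ℕ) S →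
  1 ≤ 𝟙 (independentᵇ (tabulate λ e → A e , b e) S) + Vec.sum (tabulate λ e → 𝟙 (over (b e) (S ∩ A e)))
1≤independent+over {k = k} A b S with all? (λ e → ∣ S ∩ proj₁ (lookup (tabulate λ e → A e , b e) e) ∣ ℕ.≤? proj₂ (lookup (tabulate λ e → A e , b e) e))
... | yes _   = s≤s z≤n
... | no  dep with e , ≰ ← ¬∀⟶∃¬ k _ (λ e → _ ℕ.≤? _) dep
  rewrite lookup∘tabulate (λ e → A e , b e) e =
  ≤-trans (≤-reflexive (sym (cong 𝟙 (over⁺ (b e) (S ∩ A e) (≰⇒> ≰))))) (x≤sum (λ e → 𝟙 (over (b e) (S ∩ A e))) e)

-- A part counts as unlikely to be exceeded if this has probability ≤ 1/H n.
H : ℕ → ℕ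
H n = 2 * suc n

-- The inverse of 1/(2H²) · 1/2: the part is exceeded, and no other remaining part is.
sparsity : ℕ → ℕ
sparsity n = 4 * (H n * H n)

module Isolation {n} (M : PartitionMatroid n) where
  open PartitionMatroid M

  part : Fin n → Fin m
  part e = proj₁ (cover e)

  parts : Vec (Subset n × ℕ) n
  parts = tabulate λ e → A (part e) , b (part e)

  instanceAt : Subset n → Fin m → Instance n
  instanceAt U i = (A i , b i) ∷ parts , U

  overWeight : ℕ → ℕ → Fin m → ℕ
  overWeight a c j = wsum a c (A j) (𝟙 ∘ over (b j))

  -- The first alternative covers parts already removed, whose probability of being exceeded no
  -- longer matters.
  QuietAt : ℕ → ℕ → Subset n → Fin m → Set
  QuietAt a c U j = ∣ U ∩ A j ∣ ≡ 0 ⊎ H n * overWeight a c j ≤ (a + c) ^ ∣ A j ∣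

  module _ a c .{{_ : NonZero (a + c)}} (U : Subset n) (quiet : ∀ j → QuietAt a c U j) (i : Fin m) where

    private
      Z = a + c

      rest-free : Subset n → ℕ
      rest-free V = 𝟙 (independentᵇ parts (V ∩ U))

      rest-over : Fin n → Subset n → ℕ
      rest-over e S = 𝟙 (over (b (part e)) (((S ∩ ∁ (A i)) ∩ U) ∩ A (part e)))

      -- Restricting S to U and to the complement of `A i` can only make it rarer that the part of e
      -- is exceeded.
      rest-over-rare : ∀ e → H n * wsum a c ⊤ (rest-over e) ≤ Z ^ n
      rest-over-rare e with quiet (part e)
      ... | inj₁ ≡0 = ≤-trans (≤-reflexive (trans (cong (H n *_) wsum≡0) (*-zeroʳ (H n)))) z≤n
        where
        card≤ : ∀ S → ∣ ((S ∩ ∁ (A i)) ∩ U) ∩ A (part e) ∣ ≤ b (part e)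
        card≤ S = ≤-trans (p⊆q⇒∣p∣≤∣q∣ (∩-monoˡ (p∩q⊆q (S ∩ ∁ (A i)) U))) (≤-trans (≤-reflexive ≡0) z≤n)
        wsum≡0 : wsum a c ⊤ (rest-over e) ≡ 0
        wsum≡0 = trans (wsum-cong a c (⊤ {n}) λ S → cong 𝟙 (¬over _ (((S ∩ ∁ (A i)) ∩ U) ∩ A (part e)) (card≤ S))) (wsum-const a c (⊤ {n}) 0)
      ... | inj₂ rare = begin
        H n * wsum a c ⊤ (rest-over e)
          ≤⟨ *-monoʳ-≤ (H n) (wsum-mono a c (⊤ {n}) λ S → over-mono (b j) (∩-monoˡ (p∩q⊆p S (∁ (A i)) ∘ p∩q⊆p (S ∩ ∁ (A i)) U))) ⟩
        H n * wsum a c ⊤ (λ S → 𝟙 (over (b j) (S ∩ A j)))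
          ≡⟨ cong (H n *_) (wsum-∩ a c (A j) (𝟙 ∘ over (b j))) ⟩
        H n * (overWeight a c j * Z ^ ∣ ∁ (A j) ∣)
          ≡⟨ *-assoc (H n) (overWeight a c j) _ ⟨
        H n * overWeight a c j * Z ^ ∣ ∁ (A j) ∣
          ≤⟨ *-monoˡ-≤ (Z ^ ∣ ∁ (A j) ∣) rare ⟩
        Z ^ ∣ A j ∣ * Z ^ ∣ ∁ (A j) ∣
          ≡⟨ total-split a c (A j) ⟩
        Z ^ n ∎
        where j = part e

      -- Union bound over the parts listed by element: n events of probability at most 1/(2(n + 1))
      -- have total probability below 1/2. Everything is scaled by (n + 1) Z^∣A i∣ to stay in ℕ.
      rest-free-half : Z ^ ∣ ∁ (A i) ∣ ≤ 2 * wsum a c (∁ (A i)) rest-free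
      rest-free-half = *-cancelˡ-≤ (suc n * Z ^ ∣ A i ∣) {{m*n≢0 (suc n) (Z ^ ∣ A i ∣) {{it}} {{m^n≢0 Z ∣ A i ∣}}}}
        (+-cancelʳ-≤ (n * Z ^ n) _ _ (begin
          suc n * Z ^ ∣ A i ∣ * Z ^ ∣ ∁ (A i) ∣ + n * Z ^ n ≡⟨ cong (_+ n * Z ^ n) (trans (*-assoc (suc n) (Z ^ ∣ A i ∣) _) (cong (suc n *_) (total-split a c (A i)))) ⟩
          suc n * Z ^ n + n * Z ^ n ≤⟨ +-monoʳ-≤ (suc n * Z ^ n) (*-monoˡ-≤ (Z ^ n) (n≤1+n n)) ⟩
          suc n * Z ^ n + suc n * Z ^ n ≡⟨ eq₁ n (Z ^ n) ⟩
          H n * Z ^ n ≤⟨ *-monoʳ-≤ (H n) total≤ ⟩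
          H n * (Z ^ ∣ A i ∣ * W + wsum a c ⊤ Σover) ≡⟨ *-distribˡ-+ (H n) (Z ^ ∣ A i ∣ * W) _ ⟩
          H n * (Z ^ ∣ A i ∣ * W) + H n * wsum a c ⊤ Σover ≤⟨ +-monoʳ-≤ (H n * (Z ^ ∣ A i ∣ * W)) (wsum-Σ a c (H n) (⊤ {n}) rest-over rest-over-rare) ⟩
          H n * (Z ^ ∣ A i ∣ * W) + n * Z ^ n ≡⟨ cong (_+ n * Z ^ n) (eq₂ n (Z ^ ∣ A i ∣) W) ⟩
          suc n * Z ^ ∣ A i ∣ * (2 * W) + n * Z ^ n ∎))
        where
        W = wsum a c (∁ (A i)) rest-free
        Σover : Subset n → ℕ
        Σover S = Vec.sum (tabulate λ e → rest-over e S)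
        eq₁ : ∀ n z → suc n * z + suc n * z ≡ 2 * suc n * z
        eq₁ = solve-∀
        eq₂ : ∀ n y w → 2 * suc n * (y * w) ≡ suc n * y * (2 * w)
        eq₂ = solve-∀
        total≤ : Z ^ n ≤ Z ^ ∣ A i ∣ * W + wsum a c ⊤ Σover
        total≤ = begin
          Z ^ n                            ≡⟨ trans (wsum-const a c (⊤ {n}) 1) (trans (*-identityˡ _) (cong (Z ^_) (∣⊤∣≡n n))) ⟨
          wsum a c (⊤ {n}) (λ _ → 1)       ≤⟨ wsum-mono a c (⊤ {n}) (λ S → 1≤independent+over (A ∘ part) (b ∘ part) ((S ∩ ∁ (A i)) ∩ U)) ⟩
          wsum a c (⊤ {n}) (λ S → rest-free (S ∩ ∁ (A i)) + Σover S) ≡⟨ wsum-+ a c (⊤ {n}) _ Σover ⟩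
          wsum a c (⊤ {n}) (λ S → rest-free (S ∩ ∁ (A i))) + wsum a c ⊤ Σover ≡⟨ cong (_+ wsum a c ⊤ Σover) (wsum-cong a c (⊤ {n}) λ S → sym (*-identityˡ _)) ⟩
          wsum a c (⊤ {n}) (λ S → 1 * rest-free (S ∩ ∁ (A i))) + wsum a c ⊤ Σover ≡⟨ cong (_+ wsum a c ⊤ Σover) (wsum-∩-∁ a c (A i) (λ _ → 1) rest-free) ⟩
          wsum a c (A i) (λ _ → 1) * W + wsum a c ⊤ Σover ≡⟨ cong (λ w → w * W + wsum a c ⊤ Σover) (trans (wsum-const a c (A i) 1) (*-identityˡ _)) ⟩
          Z ^ ∣ A i ∣ * W + wsum a c ⊤ Σover ∎

    -- What happens inside `A i` is independent of what happens outside, so the bounds 1/(2H²) and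
    -- 1/2 multiply.
    isolation-likely : Z ^ ∣ A i ∣ ≤ 2 * (H n * H n) * overWeight a c i →
                       Z ^ n ≤ suc (sparsity n) * wsum a c ⊤ (𝟙 ∘ isolates (instanceAt U i))
    isolation-likely likely = begin
      Z ^ n                           ≡⟨ total-split a c (A i) ⟨
      Z ^ ∣ A i ∣ * Z ^ ∣ ∁ (A i) ∣   ≤⟨ *-mono-≤ likely rest-free-half ⟩
      2 * (H n * H n) * W₁ * (2 * W₂) ≡⟨ eq (H n) W₁ W₂ ⟩
      sparsity n * (W₁ * W₂)          ≤⟨ m≤n+m _ (W₁ * W₂) ⟩
      suc (sparsity n) * (W₁ * W₂)    ≡⟨ cong (suc (sparsity n) *_) (wsum-∩-∁ a c (A i) (𝟙 ∘ over (b i)) rest-free) ⟨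
      suc (sparsity n) * wsum a c ⊤ (λ S → 𝟙 (over (b i) (S ∩ A i)) * rest-free (S ∩ ∁ (A i)))
        ≡⟨ cong (suc (sparsity n) *_) (wsum-cong a c (⊤ {n}) λ S → 𝟙-∧ (over (b i) (S ∩ A i)) _) ⟨
      suc (sparsity n) * wsum a c ⊤ (𝟙 ∘ isolates (instanceAt U i)) ∎
      where
      W₁ = overWeight a c i
      W₂ = wsum a c (∁ (A i)) rest-free
      eq : ∀ h w₁ w₂ → 2 * (h * h) * w₁ * (2 * w₂) ≡ 4 * (h * h) * (w₁ * w₂)
      eq = solve-∀

  instanceAt-∈ : ∀ U i → instanceAt U i ∈ˡ allInstances n
  instanceAt-∈ U i = ∈-allInstances _ U budgets
    where
    budgets : ∀ e → proj₂ (lookup ((A i , b i) ∷ parts) e) ≤ n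
    budgets zero    = ≤-trans (b≤∣A∣ i) (∣p∣≤n (A i))
    budgets (suc e) = ≤-trans (≤-reflexive (cong proj₂ (lookup∘tabulate (λ e → A (part e) , b (part e)) e)))
                              (≤-trans (b≤∣A∣ (part e)) (∣p∣≤n (A (part e))))

  -- The list names every part that V meets, since it names the part of each element; the other
  -- parts impose nothing on V.
  independentᵇ⇒Independent : ∀ V → independentᵇ parts V ≡ true → Independent V
  independentᵇ⇒Independent V eq j with nonempty? (V ∩ A j)
  ... | no  empty = ≤-trans (≤-reflexive (trans (cong ∣_∣ (Empty-unique empty)) (∣⊥∣≡0 n))) z≤n
  ... | yes (e , e∈) with ≤b ← independentᵇ⁻ parts V eq e
    rewrite lookup∘tabulate (λ e → A (part e) , b (part e)) e
          | decidable-stable (part e ≟ j) (λ p≢j → disjoint p≢j (e , x∈p∩q⁺ (proj₂ (cover e) , proj₂ (x∈p∩q⁻ V (A j) e∈)))) = ≤b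

  -- Cutting S to a prefix brings the overflow down to one and cannot raise the count in any other
  -- part.
  isolates⇒prefix : ∀ {U i} S → A i ⊆ U → isolates (instanceAt U i) S ≡ true →
    ∃ λ l → ∣ ((S ∩ prefix l) ∩ U) ∩ A i ∣ ≡ suc (b i) × (∀ j → j ≢ i → ∣ ((S ∩ prefix l) ∩ U) ∩ A j ∣ ≤ b j)
  isolates⇒prefix {U} {i} S A⊆U eq with over (b i) (S ∩ A i) in overEq
  ... | true with l , size ← prefix-of-size (S ∩ A i) (suc (b i)) (over⁻ (b i) (S ∩ A i) overEq) =
    l , trans (∣∣-cong to from) size , λ j j≢i → ≤-trans (p⊆q⇒∣p∣≤∣q∣ (elsewhere j j≢i)) (independentᵇ⇒Independent ((S ∩ ∁ (A i)) ∩ U) eq j)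
    where
    to : ((S ∩ prefix l) ∩ U) ∩ A i ⊆ (S ∩ A i) ∩ prefix l
    to x∈ with x∈X , x∈A ← x∈p∩q⁻ ((S ∩ prefix l) ∩ U) (A i) x∈
      with x∈S , x∈l ← x∈p∩q⁻ S (prefix l) (p∩q⊆p (S ∩ prefix l) U x∈X) = x∈p∩q⁺ (x∈p∩q⁺ (x∈S , x∈A) , x∈l)
    from : (S ∩ A i) ∩ prefix l ⊆ ((S ∩ prefix l) ∩ U) ∩ A i
    from x∈ with x∈SA , x∈l ← x∈p∩q⁻ (S ∩ A i) (prefix l) x∈ with x∈S , x∈A ← x∈p∩q⁻ S (A i) x∈SA =
      x∈p∩q⁺ (x∈p∩q⁺ (x∈p∩q⁺ (x∈S , x∈l) , A⊆U x∈A) , x∈A)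
    elsewhere : ∀ j → j ≢ i → ((S ∩ prefix l) ∩ U) ∩ A j ⊆ ((S ∩ ∁ (A i)) ∩ U) ∩ A j
    elsewhere j j≢i x∈ with x∈X , x∈Aj ← x∈p∩q⁻ ((S ∩ prefix l) ∩ U) (A j) x∈
      with x∈Sl , x∈U ← x∈p∩q⁻ (S ∩ prefix l) U x∈X =
      x∈p∩q⁺ (x∈p∩q⁺ (x∈p∩q⁺ (p∩q⊆p S (prefix l) x∈Sl , x∉p⇒x∈∁p λ x∈Ai → disjoint j≢i (_ , x∈p∩q⁺ (x∈Aj , x∈Ai))) , x∈U) , x∈Aj)

-- Sampling levels and progress

-- At level t the odds of sampling an element are (1 + 1/grid)^t / 2^μ; they
-- run from 2^-μ at level 0 to at least 2^μ at the last level, and L levels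
-- multiply them by at most 1 + 1/κ.  Single levels are fine enough to compare
-- the sampling probabilities of parts of any size.
module Grid (n κ μ : ℕ) .{{_ : NonZero n}} .{{_ : NonZero κ}} (n≤κ³ : n ≤ κ * (κ * κ)) (Hn≤2^μ : H n * n ≤ 2 ^ μ) where

  -- `L` is both the size up to which a part is small and the number of levels handled in one
  -- iteration. `levels` leaves room for μ + μ doublings of the odds, each within `grid` levels, and
  -- `J` counts the blocks of `L` levels.
  L grid levels J : ℕ
  L      = κ * κ
  grid   = L * suc κ
  levels = grid * (μ + μ)
  J      = suc κ * (μ + μ)

  levels≡J*L : levels ≡ J * L
  levels≡J*L = eq (κ * κ) (suc κ) (μ + μ)
    where
    eq : ∀ l k u → l * k * u ≡ k * u * l
    eq = solve-∀

  instance
    L≢0 : NonZero L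
    L≢0 = m*n≢0 κ κ
    grid≢0 : NonZero grid
    grid≢0 = m*n≢0 L (suc κ)
    2^μ≢0 : NonZero (2 ^ μ)
    2^μ≢0 = m^n≢0 2 μ

  in-weight out-weight : ℕ → ℕ
  in-weight t  = suc grid ^ t
  out-weight t = 2 ^ μ * grid ^ t

  in-weight≢0 : ∀ t → NonZero (in-weight t)
  in-weight≢0 t = m^n≢0 (suc grid) t

  out-weight≢0 : ∀ t → NonZero (out-weight t)
  out-weight≢0 t = m*n≢0 (2 ^ μ) (grid ^ t) {{it}} {{m^n≢0 grid t}}

  weights≢0 : ∀ t → NonZero (in-weight t + out-weight t)
  weights≢0 t = >-nonZero (≤-trans (>-nonZero⁻¹ (in-weight t) {{in-weight≢0 t}}) (m≤m+n _ (out-weight t)))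

  -- The hypothesis s(g - h)² ≤ 2gh of `change-of-measure`, for odds multiplied by g/h = (1 +
  -- 1/grid)^l.
  Comparable : ℕ → ℕ → Set
  Comparable s l = s * ((suc grid ^ l ∸ grid ^ l) * (suc grid ^ l ∸ grid ^ l)) ≤ 2 * (suc grid ^ l * grid ^ l)

  n≤grid : n ≤ grid
  n≤grid = ≤-trans n≤κ³ (≤-trans (≤-reflexive (*-comm κ (κ * κ))) (*-monoʳ-≤ L (n≤1+n κ)))

  -- For one level g - h = 1, so it is enough that `grid` is at least n.
  comparable-adjacent : ∀ {s} → s ≤ n → Comparable s 1
  comparable-adjacent {s} s≤n rewrite *-identityʳ grid | +-∸-assoc 1 (≤-refl {grid}) | n∸n≡0 grid = begin
    s * 1                 ≡⟨ *-identityʳ s ⟩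
    s                     ≤⟨ ≤-trans s≤n n≤grid ⟩
    grid                  ≤⟨ m≤n*m grid (2 * suc grid) ⟩
    2 * suc grid * grid   ≡⟨ *-assoc 2 (suc grid) grid ⟩
    2 * (suc grid * grid) ∎

  -- (1 + 1/grid)^l ≤ 1/(1 - l/grid) ≤ 1/(1 - 1/(κ + 1)) = 1 + 1/κ, as L/grid = 1/(κ + 1).
  κ-growth : ∀ {l} → l ≤ L → κ * suc grid ^ l ≤ suc κ * grid ^ l
  κ-growth {l} l≤L = *-cancelʳ-≤ _ _ grid (begin
    κ * suc grid ^ l * grid            ≡⟨ eq₁ κ (suc grid ^ l) grid ⟩
    κ * grid * suc grid ^ l            ≤⟨ *-monoˡ-≤ (suc grid ^ l) κgrid≤ ⟩
    suc κ * z * suc grid ^ l           ≡⟨ eq₁′ (suc κ) z (suc grid ^ l) ⟩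
    suc κ * (suc grid ^ l * z)         ≤⟨ *-monoʳ-≤ (suc κ) rb ⟩
    suc κ * (grid ^ l * grid)          ≡⟨ *-assoc (suc κ) (grid ^ l) grid ⟨
    suc κ * grid ^ l * grid            ∎)
    where
    z = grid ∸ l
    l≤grid : l ≤ grid
    l≤grid = ≤-trans l≤L (m≤m*n L (suc κ))
    eq₁ : ∀ k p g → k * p * g ≡ k * g * p
    eq₁ = solve-∀
    eq₁′ : ∀ k z p → k * z * p ≡ k * (p * z)
    eq₁′ = solve-∀
    grid≡ : l * 1 + z ≡ grid
    grid≡ = trans (cong (_+ z) (*-identityʳ l)) (m+[n∸m]≡n l≤grid)
    rb : suc grid ^ l * z ≤ grid ^ l * grid
    rb = subst₂ (λ u w → u ^ l * z ≤ w ^ l * w) (trans (+-comm _ 1) (cong suc grid≡)) grid≡ (reverse-bernoulli l 1 z)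
    κgrid≤ : κ * grid ≤ suc κ * z
    κgrid≤ = +-cancelˡ-≤ (suc κ * l) _ _ (begin
      suc κ * l + κ * grid  ≤⟨ +-monoˡ-≤ (κ * grid) (≤-trans (*-monoʳ-≤ (suc κ) l≤L) (≤-reflexive (*-comm (suc κ) L))) ⟩
      grid + κ * grid       ≡⟨ cong (suc κ *_) (m+[n∸m]≡n l≤grid) ⟨
      suc κ * (l + z)       ≡⟨ *-distribˡ-+ (suc κ) l z ⟩
      suc κ * l + suc κ * z ∎)

  -- By `κ-growth`, κ(g - h) ≤ h, and s is at most κ².
  comparable-small : ∀ {s l} → s ≤ L → l ≤ L → Comparable s l
  comparable-small {s} {l} s≤L l≤L = begin
    s * (d * d)       ≤⟨ *-monoˡ-≤ (d * d) s≤L ⟩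
    κ * κ * (d * d)   ≡⟨ eq κ d ⟩
    κ * d * (κ * d)   ≤⟨ *-mono-≤ κd≤h κd≤h ⟩
    h * h             ≤⟨ *-monoˡ-≤ h (^-monoˡ-≤ l (n≤1+n grid)) ⟩
    g * h             ≤⟨ m≤n*m (g * h) 2 ⟩
    2 * (g * h)       ∎
    where
    g = suc grid ^ l
    h = grid ^ l
    d = g ∸ h
    eq : ∀ k d → k * k * (d * d) ≡ k * d * (k * d)
    eq = solve-∀
    κd≤h : κ * d ≤ h
    κd≤h = +-cancelˡ-≤ (κ * h) _ _ (begin
      κ * h + κ * d   ≡⟨ *-distribˡ-+ κ h d ⟨
      κ * (h + d)     ≡⟨ cong (κ *_) (m+[n∸m]≡n (^-monoˡ-≤ l (n≤1+n grid))) ⟩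
      κ * g           ≤⟨ κ-growth l≤L ⟩
      h + κ * h       ≡⟨ +-comm h (κ * h) ⟩
      κ * h + h       ∎)

  shift-level : ∀ (A : Subset n) b t l → Comparable ∣ A ∣ l →
    (in-weight (t + l) + out-weight (t + l)) ^ ∣ A ∣ < H n * wsum (in-weight (t + l)) (out-weight (t + l)) A (𝟙 ∘ over b) →
    (in-weight t + out-weight t) ^ ∣ A ∣ ≤ 2 * (H n * H n) * wsum (in-weight t) (out-weight t) A (𝟙 ∘ over b)
  shift-level A b t l comparable loud =
    change-of-measure (in-weight t) (out-weight t) (grid ^ l) d (H n) A {{in-weight≢0 t}} {{out-weight≢0 t}} {{m^n≢0 grid l}} (𝟙≤1 ∘ over b)
      (subst (λ g → ∣ A ∣ * (d * d) ≤ 2 * (g * grid ^ l)) g≡ comparable)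
      (subst₂ (λ u v → (u + v) ^ ∣ A ∣ ≤ H n * wsum u v A (𝟙 ∘ over b)) in≡ out≡ (<⇒≤ loud))
    where
    d = suc grid ^ l ∸ grid ^ l
    g≡ : suc grid ^ l ≡ grid ^ l + d
    g≡ = sym (m+[n∸m]≡n (^-monoˡ-≤ l (n≤1+n grid)))
    in≡ : in-weight (t + l) ≡ in-weight t * (grid ^ l + d)
    in≡ = trans (^-distribˡ-+-* (suc grid) t l) (cong (in-weight t *_) g≡)
    out≡ : out-weight (t + l) ≡ out-weight t * grid ^ l
    out≡ = trans (cong (2 ^ μ *_) (^-distribˡ-+-* grid t l)) (sym (*-assoc (2 ^ μ) (grid ^ t) (grid ^ l)))

  -- Exceeding a budget requires a nonempty sample, which at odds 2^-μ has probability at most s/2^μ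
  -- ≤ 1/H.
  quiet-at-first-level : ∀ (A : Subset n) b → H n * wsum (in-weight 0) (out-weight 0) A (𝟙 ∘ over b) ≤ (in-weight 0 + out-weight 0) ^ ∣ A ∣
  quiet-at-first-level A b = *-cancelʳ-≤ _ _ c {{out-weight≢0 0}} (begin
    H n * W * c        ≡⟨ *-assoc (H n) W c ⟩
    H n * (W * c)      ≤⟨ *-monoʳ-≤ (H n) Wc≤Zs ⟩
    H n * (Z * s)      ≡⟨ eq (H n) Z s ⟩
    Z * (H n * s)      ≤⟨ *-monoʳ-≤ Z Hs≤c ⟩
    Z * c              ∎)
    where
    c = out-weight 0
    s = ∣ A ∣
    W = wsum 1 c A (𝟙 ∘ over b)
    Z = (1 + c) ^ s
    eq : ∀ h z s → h * (z * s) ≡ z * (h * s)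
    eq = solve-∀
    Hs≤c : H n * s ≤ c
    Hs≤c = ≤-trans (*-monoʳ-≤ (H n) (∣p∣≤n A)) (≤-trans Hn≤2^μ (≤-reflexive (sym (*-identityʳ (2 ^ μ)))))
    s≤c : s ≤ c
    s≤c = ≤-trans (m≤n*m s (H n)) Hs≤c
    z = c ∸ s
    c≡ : s * 1 + z ≡ c
    c≡ = trans (cong (_+ z) (*-identityʳ s)) (m+[n∸m]≡n s≤c)
    Zz≤ : Z * z ≤ c ^ s * c
    Zz≤ = subst₂ (λ u w → u ^ s * z ≤ w ^ s * w) (trans (+-comm _ 1) (cong suc c≡)) c≡ (reverse-bernoulli s 1 z)
    Wc≤Zs : W * c ≤ Z * s
    Wc≤Zs = +-cancelʳ-≤ (Z * z) _ _ (begin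
      W * c + Z * z      ≤⟨ +-monoʳ-≤ (W * c) Zz≤ ⟩
      W * c + c ^ s * c  ≡⟨ *-distribʳ-+ c W (c ^ s) ⟨
      (W + c ^ s) * c    ≤⟨ *-monoˡ-≤ c (wsum+empty≤total 1 c A (𝟙≤1 ∘ over b) (cong 𝟙 (¬over b (⊥ {n}) (≤-trans (≤-reflexive (∣⊥∣≡0 n)) z≤n)))) ⟩
      Z * c              ≡⟨ cong (Z *_) (m+[n∸m]≡n s≤c) ⟨
      Z * (s + z)        ≡⟨ *-distribˡ-+ Z s z ⟩
      Z * s + Z * z      ∎)

  -- Every `grid` levels at least double the odds, and 2μ doublings lead from 2^-μ to 2^μ.
  last-odds : 2 ^ μ * out-weight levels ≤ in-weight levels
  last-odds = begin
    2 ^ μ * (2 ^ μ * grid ^ levels)            ≡⟨ *-assoc (2 ^ μ) (2 ^ μ) (grid ^ levels) ⟨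
    2 ^ μ * 2 ^ μ * grid ^ levels              ≡⟨ cong₂ _*_ (^-distribˡ-+-* 2 μ μ) (^-*-assoc grid grid (μ + μ)) ⟨
    2 ^ (μ + μ) * (grid ^ grid) ^ (μ + μ)      ≡⟨ ^-distribʳ-* 2 (grid ^ grid) (μ + μ) ⟨
    (2 * grid ^ grid) ^ (μ + μ)                ≤⟨ ^-monoˡ-≤ (μ + μ) (2*x^x≤[1+x]^x grid) ⟩
    (suc grid ^ grid) ^ (μ + μ)                ≡⟨ ^-*-assoc (suc grid) grid (μ + μ) ⟩
    suc grid ^ levels                          ∎

  2<H : 2 < H n
  2<H = *-monoʳ-< 2 (s≤s (>-nonZero⁻¹ n))

  -- At such odds the whole of A is sampled with probability at least 1/2, which is more than 1/H.
  loud-at-last-level : ∀ (A : Subset n) b → b < ∣ A ∣ →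
    (in-weight levels + out-weight levels) ^ ∣ A ∣ < H n * wsum (in-weight levels) (out-weight levels) A (𝟙 ∘ over b)
  loud-at-last-level A b b<∣A∣ = begin-strict
    (a + c) ^ s            ≤⟨ [x+y]^s≤2x^s s a c {{in-weight≢0 levels}} 2sc≤a ⟩
    2 * a ^ s              <⟨ *-monoˡ-< (a ^ s) {{m^n≢0 a s {{in-weight≢0 levels}}}} 2<H ⟩
    H n * a ^ s            ≡⟨ cong (H n *_) (trans (cong (λ o → 𝟙 o * a ^ s) (over⁺ b A b<∣A∣)) (*-identityˡ (a ^ s))) ⟨
    H n * (𝟙 (over b A) * a ^ s) ≤⟨ *-monoʳ-≤ (H n) (wsum≥full a c A (𝟙 ∘ over b)) ⟩
    H n * wsum a c A (𝟙 ∘ over b) ∎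
    where
    a = in-weight levels
    c = out-weight levels
    s = ∣ A ∣
    2sc≤a : 2 * (s * c) ≤ a
    2sc≤a = begin
      2 * (s * c)   ≡⟨ *-assoc 2 s c ⟨
      2 * s * c     ≤⟨ *-monoˡ-≤ c (≤-trans (*-mono-≤ (<⇒≤ 2<H) (∣p∣≤n A)) Hn≤2^μ) ⟩
      2 ^ μ * c     ≤⟨ last-odds ⟩
      a             ∎

  -- Each iteration queries the samples of all levels: which level is the useful one is known only
  -- to the analysis.
  samplesPerLevel candidates : ℕ
  samplesPerLevel = familySize n (sparsity n)
  candidates      = suc levels * (samplesPerLevel * suc n)

  family : ∀ t → ∃ λ (F : Fin samplesPerLevel → Subset n) → ∀ {I} → I ∈ˡ allInstances n →
           (in-weight t + out-weight t) ^ n ≤ suc (sparsity n) * wsum (in-weight t) (out-weight t) ⊤ (𝟙 ∘ isolates I) →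
           ∃ λ j → isolates I (F j) ≡ true
  family t = isolating-family n (in-weight t) (out-weight t) (sparsity n) {{weights≢0 t}}

  sample : Fin (suc levels) → Fin samplesPerLevel → Fin (suc n) → Subset n
  sample t j l = proj₁ (family (toℕ t)) j ∩ prefix l

  candidate : Fin candidates → Subset n
  candidate = flatten {suc levels} {samplesPerLevel * suc n} λ t → flatten {samplesPerLevel} {suc n} (sample t)

  candidate-combine : ∀ t j l → candidate (combine t (combine j l)) ≡ sample t j l
  candidate-combine t j l = trans (flatten-combine {suc levels} {samplesPerLevel * suc n} (λ t → flatten (sample t)) t (combine j l))
                                  (flatten-combine {samplesPerLevel} {suc n} (sample t) j l)

  open Strategy n candidates candidate public

  -- Progress in each iteration

  module Progress (M : PartitionMatroid n) where
    open PartitionMatroid M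
    open Isolation M

    quietAt : ℕ → Subset n → Fin m → Set
    quietAt t = QuietAt (in-weight t) (out-weight t)

    quietAt? : ∀ t U j → Dec (quietAt t U j)
    quietAt? t U j = (_ ℕ.≟ 0) ⊎-dec (_ ℕ.≤? _)

    Quiet : ℕ → Subset n → Set
    Quiet t U = ∀ j → quietAt t U j

    loudness : ∀ {t U B j} → Invariant M (U , B) → ¬ quietAt t U j →
               A j ⊆ U × (in-weight t + out-weight t) ^ ∣ A j ∣ < H n * overWeight (in-weight t) (out-weight t) j
    loudness {j = j} inv loud with inv j
    ... | inj₁ (A⊆U , _) = A⊆U , ≰⇒> (loud ∘ inj₂)
    ... | inj₂ (U∥A , _) = contradiction (inj₁ (∥⇒∣p∩q∣≡0 U∥A)) loud

    quietAt-⊆ : ∀ {t U U′ j} → U′ ⊆ U → quietAt t U j → quietAt t U′ j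
    quietAt-⊆ U′⊆U (inj₁ ≡0) = inj₁ (n≤0⇒n≡0 (≤-trans (p⊆q⇒∣p∣≤∣q∣ (∩-monoˡ U′⊆U)) (≤-reflexive ≡0)))
    quietAt-⊆ U′⊆U (inj₂ ≤)  = inj₂ ≤

    -- The successful sample belongs to level t, where the other parts rarely interfere; being loud
    -- at t + l still makes part j likely enough to be exceeded there.
    step-finds : ∀ {t l U B j} → t ≤ levels → Invariant M (U , B) → Quiet t U → Comparable ∣ A j ∣ l → ¬ quietAt (t + l) U j →
                 proj₁ (step oracle (U , B)) ∥ A j
    step-finds {t} {l} {U} {B} {j} t≤ inv quiet comparable loud = step-removes M U B (combine t′ (combine k p))
      (subst (λ X → OverOnlyAt M (X ∩ U) j) (sym candidate≡) (record { over-by-one = proj₁ (proj₂ prefixed) ; elsewhere = proj₂ (proj₂ prefixed) }))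
      where
      t′ : Fin (suc levels)
      t′ = fromℕ< (s≤s t≤)
      louder : A j ⊆ U × (in-weight (t + l) + out-weight (t + l)) ^ ∣ A j ∣ < H n * overWeight (in-weight (t + l)) (out-weight (t + l)) j
      louder = loudness {t + l} inv loud
      isolated : ∃ λ k → isolates (instanceAt U j) (proj₁ (family t) k) ≡ true
      isolated = proj₂ (family t) (instanceAt-∈ U j)
        (isolation-likely (in-weight t) (out-weight t) {{weights≢0 t}} U quiet j (shift-level (A j) (b j) t l comparable (proj₂ louder)))
      k = proj₁ isolated
      prefixed : ∃ λ p → ∣ ((proj₁ (family t) k ∩ prefix p) ∩ U) ∩ A j ∣ ≡ suc (b j) ×
                         (∀ i → i ≢ j → ∣ ((proj₁ (family t) k ∩ prefix p) ∩ U) ∩ A i ∣ ≤ b i)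
      prefixed = isolates⇒prefix (proj₁ (family t) k) (proj₁ louder) (proj₂ isolated)
      p = proj₁ prefixed
      candidate≡ : candidate (combine t′ (combine k p)) ≡ proj₁ (family t) k ∩ prefix p
      candidate≡ = trans (candidate-combine t′ k p) (cong (λ u → proj₁ (family u) k ∩ prefix p) (toℕ-fromℕ< (s≤s t≤)))

    -- All parts are quiet at level 0, so climbing by single levels either stays quiet or stops at a
    -- quiet level right below a loud one. Adjacent levels are `Comparable` for parts of every size.
    first-loud : ∀ U u → Quiet u U ⊎ ∃ λ t → t < u × Quiet t U × ∃ λ j → ¬ quietAt (suc t) U j
    first-loud U zero    = inj₁ λ j → inj₂ (quiet-at-first-level (A j) (b j))
    first-loud U (suc u) with first-loud U u
    ... | inj₂ (t , t<u , rest) = inj₂ (t , m<n⇒m<1+n t<u , rest)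
    ... | inj₁ quiet with all? (quietAt? (suc u) U)
    ... | yes quiet′ = inj₁ quiet′
    ... | no  loud   = inj₂ (u , n<1+n u , quiet , ¬∀⟶∃¬ m _ (quietAt? (suc u) U) loud)

    quiet-at-last-level : ∀ {U B} → Invariant M (U , B) → Quiet levels U → Independent U
    quiet-at-last-level {U} inv quiet j with ∣ U ∩ A j ∣ ℕ.≤? b j
    ... | yes ≤b = ≤b
    ... | no  ≰b with quiet j
    ... | inj₁ ≡0   = ≤-trans (≤-reflexive ≡0) z≤n
    ... | inj₂ rare = contradiction rare (<⇒≱ (loud-at-last-level (A j) (b j) (≤-trans (≰⇒> ≰b) (∣p∩q∣≤∣q∣ U (A j)))))

    Small : Fin m → Set
    Small j = ∣ A j ∣ ≤ L

    SmallQuietUpTo : ℕ → Subset n → Set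
    SmallQuietUpTo u U = ∀ t → t ≤ u → ∀ j → Small j → quietAt t U j

    -- For the small parts v blocks of `L` levels are settled, and w are left.
    data Advance (v w : ℕ) (U U′ : Subset n) : Set where
      finished    : Independent U → Advance v w U U′
      large-found : ∀ j → ¬ Small j → A j ⊆ U → U′ ∥ A j → Advance v w U U′
      next-level  : w ≢ 0 → SmallQuietUpTo (suc v * L) U′ → Advance v w U U′

    -- A part loud at or below level v · L must be large, and the step finds it. If there is none,
    -- everything is quiet at v · L, and the step finds all small parts that become loud within the
    -- next `L` levels.
    advance : ∀ {U B U′} v w → v + w ≡ J → Invariant M (U , B) → SmallQuietUpTo (v * L) U → U′ ⊆ U →
              (∀ {t l j} → t ≤ levels → Quiet t U → Comparable ∣ A j ∣ l → ¬ quietAt (t + l) U j → U′ ∥ A j) →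
              Advance v w U U′
    advance {U} {B} {U′} v w v+w≡J inv small-quiet U′⊆U finds with first-loud U (v * L)
    ... | inj₂ (t , t<vL , quiet , j , loud) = large-found j
            (λ small → loud (small-quiet (suc t) t<vL j small))
            (proj₁ (loudness {suc t} inv loud))
            (finds {t} {1} {j} (≤-trans (<⇒≤ t<vL) vL≤) quiet (comparable-adjacent (∣p∣≤n (A j))) (subst (λ u → ¬ quietAt u U j) (+-comm 1 t) loud))
      where
      vL≤ : v * L ≤ levels
      vL≤ = ≤-trans (*-monoˡ-≤ L (≤-trans (m≤m+n v w) (≤-reflexive v+w≡J))) (≤-reflexive (sym levels≡J*L))
    ... | inj₁ quiet with w ℕ.≟ 0
    ... | yes w≡0 = finished (quiet-at-last-level inv (subst (λ u → Quiet u U) v*L≡levels quiet))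
      where
      v*L≡levels : v * L ≡ levels
      v*L≡levels = trans (cong (_* L) (trans (sym (+-identityʳ v)) (trans (cong (v +_) (sym w≡0)) v+w≡J))) (sym levels≡J*L)
    ... | no  w≢0 = next-level w≢0 next
      where
      vL≤ : v * L ≤ levels
      vL≤ = ≤-trans (*-monoˡ-≤ L (≤-trans (m≤m+n v w) (≤-reflexive v+w≡J))) (≤-reflexive (sym levels≡J*L))
      next : SmallQuietUpTo (suc v * L) U′
      next t t≤ j small with t ℕ.≤? v * L
      ... | yes t≤vL = quietAt-⊆ {t} {U} {U′} {j} U′⊆U (small-quiet t t≤vL j small)
      ... | no  t≰vL with quietAt? t U j
      ... | yes quiet-t = quietAt-⊆ {t} {U} {U′} {j} U′⊆U quiet-t
      ... | no  loud = inj₁ (∥⇒∣p∩q∣≡0 (finds {v * L} {l} {j} vL≤ quiet (comparable-small small l≤L) (subst (λ u → ¬ quietAt u U j) (sym t≡) loud)))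
        where
        l = t ∸ v * L
        t≡ : v * L + l ≡ t
        t≡ = m+[n∸m]≡n (<⇒≤ (≰⇒> t≰vL))
        l≤L : l ≤ L
        l≤L = +-cancelˡ-≤ (v * L) _ _ (≤-trans (≤-reflexive t≡) (≤-trans t≤ (≤-reflexive (+-comm L (v * L)))))

    -- The potential is r + w, where r bounds the number of large parts that fit into U and w counts
    -- the blocks left. Until U is independent, each iteration lowers one of them.
    strategy-solves : ∀ k r v w U B → Invariant M (U , B) → SmallQuietUpTo (v * L) U → v + w ≡ J →
                     ∣ U ∣ ≤ r * L → r + w < k → Solves M k (U , B)
    strategy-solves (suc k) r v w U B inv small-quiet v+w≡J ∣U∣≤ (s≤s r+w≤k) = solves-after-step M k (U , B)
      (continue w v+w≡J r+w≤k (advance {U} {B} {U′} v w v+w≡J inv small-quiet U′⊆U (λ {t} {l} {j} → finds {t} {l} {j})))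
      where
      U′ B′ : Subset n
      U′ = proj₁ (step oracle (U , B))
      B′ = proj₂ (step oracle (U , B))
      inv′ : Invariant M (U′ , B′)
      inv′ = step-invariant M inv
      U′⊆U : U′ ⊆ U
      U′⊆U = step-⊆ M (U , B)
      finds : ∀ {t l j} → t ≤ levels → Quiet t U → Comparable ∣ A j ∣ l → ¬ quietAt (t + l) U j → U′ ∥ A j
      finds {t} {l} {j} t≤ = step-finds {t} {l} {U} {B} {j} t≤ inv
      continue : ∀ w → v + w ≡ J → r + w ≤ k → Advance v w U U′ → Solves M k (U′ , B′)
      continue w v+w≡J r+w≤k (finished ind) = solves-independent M k (U′ , B′) inv′ λ j → ≤-trans (p⊆q⇒∣p∣≤∣q∣ (∩-monoˡ {p = U′} {U} U′⊆U)) (ind j)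
      continue zero v+w≡J r+w≤k (next-level 0≢0 _) = contradiction refl 0≢0
      continue (suc w) v+w≡J r+w≤k (next-level _ small-quiet′) =
        strategy-solves k r (suc v) w U′ B′ inv′ small-quiet′ (trans (sym (+-suc v w)) v+w≡J)
          (≤-trans (p⊆q⇒∣p∣≤∣q∣ U′⊆U) ∣U∣≤) (subst (_≤ k) (+-suc r w) r+w≤k)
      continue w v+w≡J r+w≤k (large-found j large A⊆U U′∥A) = remove-large r ∣U∣≤ r+w≤k
        where
        shrinks : ∣ U′ ∣ + ∣ A j ∣ ≤ ∣ U ∣
        shrinks = ≤-trans (≤-reflexive (sym (∥⇒∣p∪q∣≡∣p∣+∣q∣ U′ (A j) U′∥A)))
          (p⊆q⇒∣p∣≤∣q∣ λ x∈ → [ U′⊆U , A⊆U ]′ (x∈p∪q⁻ U′ (A j) x∈))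
        remove-large : ∀ r → ∣ U ∣ ≤ r * L → r + w ≤ k → Solves M k (U′ , B′)
        -- A large part is nonempty, so it does not fit into an empty U.
        remove-large zero    ∣U∣≤0 _ = contradiction (≤-trans (≤-trans (m≤n+m ∣ A j ∣ ∣ U′ ∣) (≤-trans shrinks ∣U∣≤0)) z≤n) large
        remove-large (suc r) ∣U∣≤ r+w<k = strategy-solves k r v w U′ B′ inv′
          (λ t t≤ i small → quietAt-⊆ {t} {U} {U′} {i} U′⊆U (small-quiet t t≤ i small)) v+w≡J
          (+-cancelˡ-≤ L _ _ (begin
            L + ∣ U′ ∣       ≤⟨ +-monoˡ-≤ ∣ U′ ∣ (≰⇒≥ large) ⟩
            ∣ A j ∣ + ∣ U′ ∣ ≡⟨ +-comm ∣ A j ∣ ∣ U′ ∣ ⟩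
            ∣ U′ ∣ + ∣ A j ∣ ≤⟨ shrinks ⟩
            ∣ U ∣            ≤⟨ ∣U∣≤ ⟩
            L + r * L        ∎)) r+w<k

    initial-solves : Solves M (suc (κ + J)) (⊤ , ⊥)
    -- n ≤ κ³ = κ · L, so κ bounds the number of large parts at the start.
    initial-solves = strategy-solves (suc (κ + J)) κ 0 J ⊤ ⊥
      (λ j → inj₁ ((λ _ → ∈⊤) , λ x∈⊥ _ → ∉⊥ x∈⊥))
      (λ { zero _ j _ → inj₂ (quiet-at-first-level (A j) (b j)) })
      refl (≤-trans (≤-reflexive (∣⊤∣≡n n)) n≤κ³) ≤-refl

  iterations : ℕ
  iterations = suc (κ + J)

  abstract
    algorithm : Algorithm n
    algorithm = strategy iterations (⊤ , ⊥)

    algorithm-basis : ∀ M → PartitionMatroid.IsBasis M (output (PartitionMatroid.oracle M) algorithm)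
    algorithm-basis M = Solves.basis (Progress.initial-solves M)

    algorithm-rounds : ∀ o → rounds o algorithm ≡ iterations + iterations
    algorithm-rounds o = rounds-strategy o iterations (⊤ , ⊥)

    algorithm-queries : ∀ o → queries o algorithm ≡ iterations * (candidates * suc n + candidates * n)
    algorithm-queries o = queries-strategy o iterations (⊤ , ⊥)

-- Bounds in n

-- κ grows only when κ³ falls below the new argument, and κ + 1 ≤ 2κ for positive κ then costs a
-- factor 8.
cube-root : ∀ n → ∃ λ κ → n ≤ κ * (κ * κ) × κ * (κ * κ) ≤ 8 * n
cube-root zero    = 0 , z≤n , z≤n
cube-root (suc n) with cube-root n
... | κ , n≤κ³ , κ³≤8n with suc n ≤? κ * (κ * κ)
... | yes n<κ³ = κ , n<κ³ , ≤-trans κ³≤8n (*-monoʳ-≤ 8 (n≤1+n n))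
... | no  n≮κ³ = suc κ , n<[1+κ]³ , (begin
    suc κ * (suc κ * suc κ)       ≤⟨ doubled κ ⟩
    8 * suc (κ * (κ * κ))         ≤⟨ *-monoʳ-≤ 8 (≰⇒> n≮κ³) ⟩
    8 * suc n                     ∎)
  where
  n<[1+κ]³ : suc n ≤ suc κ * (suc κ * suc κ)
  n<[1+κ]³ = begin-strict
    n                       ≤⟨ n≤κ³ ⟩
    κ * (κ * κ)             <⟨ *-mono-< (n<1+n κ) (*-mono-< (n<1+n κ) (n<1+n κ)) ⟩
    suc κ * (suc κ * suc κ) ∎
  doubled : ∀ κ → suc κ * (suc κ * suc κ) ≤ 8 * suc (κ * (κ * κ))
  doubled zero      = s≤s z≤n
  doubled κ@(suc _) = begin
    suc κ * (suc κ * suc κ)             ≤⟨ *-mono-≤ 1+κ≤2κ (*-mono-≤ 1+κ≤2κ 1+κ≤2κ) ⟩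
    (κ + κ) * ((κ + κ) * (κ + κ))       ≡⟨ eq κ ⟩
    8 * (κ * (κ * κ))                   ≤⟨ *-monoʳ-≤ 8 (n≤1+n (κ * (κ * κ))) ⟩
    8 * suc (κ * (κ * κ))               ∎
    where
    1+κ≤2κ : suc κ ≤ κ + κ
    1+κ≤2κ = +-monoˡ-≤ κ (s≤s z≤n)
    eq : ∀ k → (k + k) * ((k + k) * (k + k)) ≡ 8 * (k * (k * k))
    eq = solve-∀

∛ : ℕ → ℕ
∛ n = proj₁ (cube-root n)

bits : ℕ → ℕ
bits n = suc ⌊log₂ n ⌋

n<2^bits : ∀ n → n < 2 ^ bits n
n<2^bits n = ≰⇒> λ 2^bits≤n → <-irrefl refl (begin-strict
  ⌊log₂ n ⌋           <⟨ n<1+n _ ⟩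
  bits n              ≡⟨ ⌊log₂[2^n]⌋≡n (bits n) ⟨
  ⌊log₂ 2 ^ bits n ⌋  ≤⟨ ⌊log₂⌋-mono-≤ 2^bits≤n ⟩
  ⌊log₂ n ⌋           ∎)

bits≤ : ∀ n → bits n ≤ suc n
bits≤ n = s≤s (≤-trans (⌊log₂⌋-mono-≤ (<⇒≤ (n<2^n n))) (≤-reflexive (⌊log₂[2^n]⌋≡n n)))

-- Two bit lengths for the factors n + 1 and n, and one bit for the factor 2 in `H`.
logOdds : ℕ → ℕ
logOdds n = suc (bits n + bits n)

Hn≤2^logOdds : ∀ n → H n * n ≤ 2 ^ logOdds n
Hn≤2^logOdds n = begin
  2 * suc n * n                   ≡⟨ *-assoc 2 (suc n) n ⟩
  2 * (suc n * n)                 ≤⟨ *-monoʳ-≤ 2 (*-mono-≤ (n<2^bits n) (<⇒≤ (n<2^bits n))) ⟩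
  2 * (2 ^ bits n * 2 ^ bits n)   ≡⟨ cong (2 *_) (^-distribˡ-+-* 2 (bits n) (bits n)) ⟨
  2 ^ logOdds n                   ∎

∛≢0 : ∀ n .{{_ : NonZero n}} → NonZero (∛ n)
∛≢0 n@(suc _) with cube-root n
... | zero  , () , _
... | suc _ , _  , _ = _

module At (n : ℕ) .{{n≢0 : NonZero n}} =
  Grid n (∛ n) (logOdds n) {{n≢0}} {{∛≢0 n}} (proj₁ (proj₂ (cube-root n))) (Hn≤2^logOdds n)

-- The count from the grid, written out as a function of n that is defined at 0 too, where there is
-- no grid.
iterations : ℕ → ℕ
iterations n = suc (∛ n + suc (∛ n) * (logOdds n + logOdds n))

candidateBound : ℕ → ℕ
candidateBound n = suc (∛ n * ∛ n * suc (∛ n) * (logOdds n + logOdds n)) * (familySize n (sparsity n) * suc n)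

alg : ∀ n → Algorithm n
alg zero      = return ⊥
alg n@(suc _) = At.algorithm n

roundBound : ℕ → ℕ
roundBound zero      = 0
roundBound n@(suc _) = iterations n + iterations n

queryBound : ℕ → ℕ
queryBound n = iterations n * (candidateBound n * suc n + candidateBound n * n)

-- Polynomial and root bounds

private
  variable
    f g : ℕ → ℕ

poly-mono : (∀ n → f n ≤ g n) → PolynomiallyBounded g → PolynomiallyBounded f
poly-mono f≤g (c , d , g≤) = c , d , λ n → ≤-trans (f≤g n) (g≤ n)

poly-const : ∀ k → PolynomiallyBounded (λ _ → k)
poly-const k = k , 0 , λ n → ≤-reflexive (sym (*-identityʳ k))

poly-id : PolynomiallyBounded (λ n → n)
poly-id = 1 , 1 , λ n → ≤-trans (n≤1+n n) (≤-reflexive (sym (trans (*-identityˡ _) (*-identityʳ (suc n)))))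

poly-+ : PolynomiallyBounded f → PolynomiallyBounded g → PolynomiallyBounded (λ n → f n + g n)
poly-+ {f} {g} (c , d , f≤) (c′ , d′ , g≤) = c + c′ , d + d′ , λ n → begin
  f n + g n                                   ≤⟨ +-mono-≤ (f≤ n) (g≤ n) ⟩
  c * suc n ^ d + c′ * suc n ^ d′             ≤⟨ +-mono-≤ (*-monoʳ-≤ c (^-monoʳ-≤ (suc n) (m≤m+n d d′))) (*-monoʳ-≤ c′ (^-monoʳ-≤ (suc n) (m≤n+m d′ d))) ⟩
  c * suc n ^ (d + d′) + c′ * suc n ^ (d + d′) ≡⟨ *-distribʳ-+ (suc n ^ (d + d′)) c c′ ⟨
  (c + c′) * suc n ^ (d + d′)                 ∎

poly-* : PolynomiallyBounded f → PolynomiallyBounded g → PolynomiallyBounded (λ n → f n * g n)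
poly-* {f} {g} (c , d , f≤) (c′ , d′ , g≤) = c * c′ , d + d′ , λ n → begin
  f n * g n                                   ≤⟨ *-mono-≤ (f≤ n) (g≤ n) ⟩
  c * suc n ^ d * (c′ * suc n ^ d′)           ≡⟨ eq c c′ (suc n ^ d) (suc n ^ d′) ⟩
  c * c′ * (suc n ^ d * suc n ^ d′)           ≡⟨ cong (c * c′ *_) (^-distribˡ-+-* (suc n) d d′) ⟨
  c * c′ * suc n ^ (d + d′)                   ∎
  where
  eq : ∀ c c′ p q → c * p * (c′ * q) ≡ c * c′ * (p * q)
  eq = solve-∀

poly-suc : PolynomiallyBounded f → PolynomiallyBounded (λ n → suc (f n))
poly-suc = poly-+ (poly-const 1)

poly-∛ : PolynomiallyBounded ∛
poly-∛ = poly-mono (λ n → ≤-trans (κ≤κ³ (∛ n)) (proj₂ (proj₂ (cube-root n)))) (poly-* (poly-const 8) poly-id)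
  where
  κ≤κ³ : ∀ κ → κ ≤ κ * (κ * κ)
  κ≤κ³ zero      = z≤n
  κ≤κ³ κ@(suc _) = m≤m*n κ (κ * κ)

poly-logOdds : PolynomiallyBounded logOdds
poly-logOdds = poly-suc (poly-+ poly-bits poly-bits)
  where
  poly-bits : PolynomiallyBounded bits
  poly-bits = poly-mono bits≤ (poly-suc poly-id)

queryBound-poly : PolynomiallyBounded queryBound
queryBound-poly = poly-* poly-iterations (poly-+ (poly-* poly-candidates poly-sucid) (poly-* poly-candidates poly-id))
  where
  poly-sucid : PolynomiallyBounded suc
  poly-sucid = poly-suc poly-id
  poly-2logOdds : PolynomiallyBounded (λ n → logOdds n + logOdds n)
  poly-2logOdds = poly-+ poly-logOdds poly-logOdds
  poly-iterations : PolynomiallyBounded iterations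
  poly-iterations = poly-suc (poly-+ poly-∛ (poly-* (poly-suc poly-∛) poly-2logOdds))
  poly-H : PolynomiallyBounded H
  poly-H = poly-* (poly-const 2) poly-sucid
  poly-instanceBits : PolynomiallyBounded instanceBits
  poly-instanceBits = poly-suc (poly-+ (poly-* (poly-+ poly-id poly-id) poly-sucid) poly-id)
  poly-familySize : PolynomiallyBounded (λ n → familySize n (sparsity n))
  poly-familySize = poly-* (poly-* (poly-const 4) (poly-* poly-H poly-H)) poly-instanceBits
  poly-candidates : PolynomiallyBounded candidateBound
  poly-candidates = poly-* (poly-suc (poly-* (poly-* (poly-* poly-∛ poly-∛) (poly-suc poly-∛)) poly-2logOdds))
                           (poly-* poly-familySize poly-sucid)

roundBound-Õ : IsÕ[∛n] roundBound
-- 28 is the number of rounds when κ and the bit length are both 1. The factor 2 is the cube root of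
-- the 8 in `cube-root`, and one power of the logarithm suffices.
roundBound-Õ = 2 * 28 , 1 , bound
  where
  k+k≤ : ∀ κ l → 1 ≤ κ → 1 ≤ l → let μ = suc (l + l) ; k = suc (κ + suc κ * (μ + μ)) in k + k ≤ 28 * (κ * l)
  k+k≤ (suc x) (suc y) _ _ = ≤-trans (m≤m+n _ (14 * x + 12 * y + 20 * (x * y))) (≤-reflexive (eq x y))
    where
    eq : ∀ x y → let μ = suc (suc y + suc y) ; k = suc (suc x + suc (suc x) * (μ + μ)) in
         k + k + (14 * x + 12 * y + 20 * (x * y)) ≡ 28 * (suc x * suc y)
    eq = solve-∀
  bound : ∀ n → roundBound n ^ 3 ≤ (2 * 28 * bits n ^ 1) ^ 3 * n
  bound zero      = z≤n
  bound n@(suc _) = begin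
    roundBound n ^ 3                  ≤⟨ ^-monoˡ-≤ 3 (k+k≤ (∛ n) (bits n) (>-nonZero⁻¹ (∛ n) {{∛≢0 n}}) (s≤s z≤n)) ⟩
    (28 * (∛ n * bits n)) ^ 3         ≡⟨ eq₁ 28 (∛ n) (bits n) ⟩
    (28 * bits n) ^ 3 * (∛ n * (∛ n * ∛ n)) ≤⟨ *-monoʳ-≤ ((28 * bits n) ^ 3) (proj₂ (proj₂ (cube-root n))) ⟩
    (28 * bits n) ^ 3 * (8 * n)       ≡⟨ eq₂ 28 (bits n) n ⟩
    (2 * 28 * bits n ^ 1) ^ 3 * n     ∎
    where
    eq₁ : ∀ c k l → let p = c * (k * l) ; q = c * l in p * (p * (p * 1)) ≡ q * (q * (q * 1)) * (k * (k * k))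
    eq₁ = solve-∀
    eq₂ : ∀ c l n → let q = c * l ; r = 2 * c * (l * 1) in q * (q * (q * 1)) * (8 * n) ≡ r * (r * (r * 1)) * n
    eq₂ = solve-∀

theorem1p3 : Σ[ alg ∈ (∀ n → Algorithm n) ] Σ[ R ∈ (ℕ → ℕ) ] Σ[ Q ∈ (ℕ → ℕ) ]
    IsÕ[∛n] R × PolynomiallyBounded Q ×
    (∀ n (M : PartitionMatroid n) →
    let open PartitionMatroid M in
    IsBasis (output oracle (alg n)) ×
    rounds oracle (alg n) ≤ R n ×
    queries oracle (alg n) ≤ Q n)
theorem1p3 = alg , roundBound , queryBound , roundBound-Õ , queryBound-poly , correct
  where
  correct : ∀ n (M : PartitionMatroid n) → let open PartitionMatroid M in
            IsBasis (output oracle (alg n)) × rounds oracle (alg n) ≤ roundBound n × queries oracle (alg n) ≤ queryBound n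
  correct zero M = ((λ i → ≤-trans (∣p∩q∣≤∣p∣ ⊥ (A i)) z≤n) , λ { (_ , () , _) }) , z≤n , z≤n
    where open PartitionMatroid M
  correct n@(suc _) M = At.algorithm-basis n M
    , ≤-reflexive (At.algorithm-rounds n (PartitionMatroid.oracle M))
    , ≤-reflexive (At.algorithm-queries n (PartitionMatroid.oracle M))
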